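{- Let $G$ be the intersection graph of a family $\mathcal{R}$ of $n$ unit-width rectangles. One can compute, in $O(n\log n)$ time, a tree decomposition $\mathcal{T}=(T,\{X_t\}_{t\in V(T)})$ and a layering $(V_1,V_2,\ldots)$ of $G$ such that $|V(T)|=O(n)$ and $\alpha(G[X_t\cap V_i])\le1$ for every bag $X_t$ and layer $V_i$. In particular, $G$ has layered tree-independence number at most $1$.
   Context: A family of unit-width rectangles is a family of axis-aligned closed rectangles in $\mathbb{R}^2$ all having the same width (horizontal side length), each given by its four corners; its intersection graph has a vertex per rectangle, two adjacent iff they intersect. $\alpha$ denotes independence number. A tree decomposition of $G$ is a pair $(T,\{X_t\})$ with $T$ a tree and bags $X_t\subseteq V(G)$ such that every vertex lies in some bag, every edge has both ends in some bag, and for each vertex the nodes whose bags contain it induce a connected subtree. A layering of $G$ is a partition $(V_1,V_2,\ldots)$ of $V(G)$ such that every edge joins vertices in the same or consecutive layers. The layered tree-independence number of $G$ is the minimum over tree decompositions and layerings of $\max_{t,i}\alpha(G[X_t\cap V_i])$. -}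

module Defs where

open import Algebra.Bundles using (CommutativeRing)
open import Data.Bool.Base using (Bool; true; false; not; _∧_; _∨_; if_then_else_)
open import Data.Fin.Base using (Fin; zero; suc; toℕ; fromℕ; fromℕ<; inject₁)
open import Data.Fin.Properties using (all?) renaming (_≟_ to _≟ᶠ_)
open import Data.Fin.Subset using (Subset; inside; outside; _∈_; _⊆_; _∩_; ∣_∣)
open import Data.Fin.Subset.Properties using (_∈?_; _⊆?_)
open import Data.List.Base using (List; []; _∷_; [_]; _++_; _∷ʳ_; map; filter; length; concat; tabulate)
open import Data.List.Extrema.Nat using (max)
open import Data.List.Membership.Propositional using () renaming (_∈_ to _∈ₗ_; _∉_ to _∉ₗ_)
open import Data.Nat.Base as ℕ using (ℕ; zero; suc; _+_; _*_; _∸_; ∣_-_∣; NonZero)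
open import Data.Nat.Properties using (_≟_; _<?_)
open import Data.Product.Base using (Σ; ∃; ∃₂; _×_; _,_; proj₁; proj₂)
open import Data.Sum.Base using (_⊎_; inj₁; inj₂)
open import Data.Vec.Base as Vec using (Vec; lookup)
open import Function.Bundles using (_⇔_)
open import Function.Definitions using (Injective)
open import Level using (Level; 0ℓ; _⊔_) renaming (suc to lsuc)
open import Relation.Binary.Construct.Closure.ReflexiveTransitive using (Star)
open import Relation.Binary.Core using (Rel)
open import Relation.Binary.Definitions using (Symmetric; Decidable)
open import Relation.Binary.PropositionalEquality.Core using (_≡_; _≢_; refl) renaming (sym to ≡-sym)
open import Relation.Binary.Structures using (IsDecTotalOrder)
open import Relation.Nullary.Decidable.Core using (Dec; yes; no; does; ¬?; map′; _×-dec_; _→-dec_)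
open import Relation.Nullary.Negation.Core using (¬_)

infix 4 _∈O_

_∈O_ : (ℕ → ℕ) → (ℕ → ℕ) → Set
f ∈O g = ∃₂ λ C N → ∀ n → N ℕ.≤ n → f n ℕ.≤ C * g n

IsMaximum : ∀ {ℓ} → (ℕ → Set ℓ) → ℕ → Set ℓ
IsMaximum P k = P k × (∀ m → P m → m ℕ.≤ k)

IsMinimum : ∀ {ℓ} → (ℕ → Set ℓ) → ℕ → Set ℓ
IsMinimum P k = P k × (∀ m → P m → k ℕ.≤ m)

record Graph (n : ℕ) (ℓ : Level) : Set (lsuc ℓ) where
  field
    Adj    : Rel (Fin n) ℓ
    adj?   : Decidable Adj
    sym    : Symmetric Adj
    irrefl : ∀ v → ¬ Adj v v

module _ {n ℓ} (G : Graph n ℓ) where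
  open Graph G

  Independent : Subset n → Set ℓ
  Independent I = ∀ u v → u ∈ I → v ∈ I → ¬ Adj u v

  independent? : ∀ I → Dec (Independent I)
  independent? I =
    all? λ u → all? λ v → (u ∈? I) →-dec ((v ∈? I) →-dec ¬? (adj? u v))

  ConnectedOn : Subset n → Set ℓ
  ConnectedOn S =
    ∀ u v → u ∈ S → v ∈ S → Star (λ x y → Adj x y × x ∈ S × y ∈ S) u v

  Connected : Set ℓ
  Connected = ∀ u v → Star Adj u v

  Acyclic : Set ℓ
  Acyclic = ∀ k (c : Fin (3 + k) → Fin n) → Injective _≡_ _≡_ c →
            (∀ (i : Fin (2 + k)) → Adj (c (inject₁ i)) (c (suc i))) →
            ¬ Adj (c (fromℕ (2 + k))) (c zero)

  record IsTree : Set ℓ where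
    field
      nonempty  : NonZero n
      connected : Connected
      acyclic   : Acyclic

subsets : ∀ n → List (Subset n)
subsets zero    = [ Vec.[] ]
subsets (suc n) = map (inside Vec.∷_) (subsets n) ++ map (outside Vec.∷_) (subsets n)

-- α G S is the independence number of the induced subgraph G[S], whose
-- independent sets are the independent sets of G contained in S.
α : ∀ {n ℓ} → Graph n ℓ → Subset n → ℕ
α {n} G S =
  max 0 (map ∣_∣ (filter (λ I → (I ⊆? S) ×-dec independent? G I) (subsets n)))

record TreeDecomposition {n ℓ} (G : Graph n ℓ) (k : ℕ) : Set (lsuc 0ℓ ⊔ ℓ) where
  open Graph G using (Adj)
  field
    tree   : Graph k 0ℓ
    isTree : IsTree tree
    bag    : Fin k → Subset n

  nodesOf : Fin n → Subset k
  nodesOf v = Vec.tabulate λ t → does (v ∈? bag t)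

  field
    vertexCovered : ∀ v → ∃ λ t → v ∈ bag t
    edgeCovered   : ∀ u v → Adj u v → ∃ λ t → u ∈ bag t × v ∈ bag t
    subtree       : ∀ v → ConnectedOn tree (nodesOf v)

-- The layers are indexed from 0 and may be empty; layer v is the index of
-- the part containing v.
record Layering {n ℓ} (G : Graph n ℓ) : Set ℓ where
  open Graph G using (Adj)
  field
    layer        : Fin n → ℕ
    edgesAreNear : ∀ u v → Adj u v → ∣ layer u - layer v ∣ ℕ.≤ 1

  part : ℕ → Subset n
  part i = Vec.tabulate λ v → does (layer v ≟ i)

module _ {n ℓ} (G : Graph n ℓ) where
  open TreeDecomposition using (bag)
  open Layering using (part)

  IsLayeredIndependence : ∀ {k} → TreeDecomposition G k → Layering G → ℕ → Set
  IsLayeredIndependence D L =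
    IsMaximum λ m → ∃₂ λ t i → α G (bag D t ∩ part L i) ≡ m

  IsLayeredTreeIndependenceNumber : ℕ → Set (lsuc 0ℓ ⊔ ℓ)
  IsLayeredTreeIndependenceNumber = IsMinimum λ m →
    ∃ λ k → Σ (TreeDecomposition G k) λ D → Σ (Layering G) λ L →
    IsLayeredIndependence D L m

-- The real numbers enter only through the laws of an ordered field with
-- decidable order. The value of 0# ⁻¹ is unspecified.
record OrderedField (c ℓ₁ ℓ₂ : Level) : Set (lsuc (c ⊔ ℓ₁ ⊔ ℓ₂)) where
  infix 4 _≤_ _<_
  field
    commutativeRing : CommutativeRing c ℓ₁

  open CommutativeRing commutativeRing public
    using (Carrier; _≈_; 0#; 1#; -_; _-_)
    renaming (_+_ to _+ᶠ_; _*_ to _*ᶠ_)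

  field
    _≤_             : Rel Carrier ℓ₂
    isDecTotalOrder : IsDecTotalOrder _≈_ _≤_
    +-monoˡ-≤       : ∀ z {x y} → x ≤ y → (x +ᶠ z) ≤ (y +ᶠ z)
    *-nonneg        : ∀ {x y} → 0# ≤ x → 0# ≤ y → 0# ≤ (x *ᶠ y)
    0≉1             : ¬ (0# ≈ 1#)
    _⁻¹             : Carrier → Carrier
    ⁻¹-cong         : ∀ {x y} → x ≈ y → (x ⁻¹) ≈ (y ⁻¹)
    ⁻¹-inverse      : ∀ x → ¬ (x ≈ 0#) → (x *ᶠ (x ⁻¹)) ≈ 1#

  module Order = IsDecTotalOrder isDecTotalOrder

  _<_ : Rel Carrier (ℓ₁ ⊔ ℓ₂)
  x < y = x ≤ y × ¬ (x ≈ y)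

module _ {c ℓ₁ ℓ₂} (F : OrderedField c ℓ₁ ℓ₂) where
  open OrderedField F

  record Rectangle : Set (c ⊔ ℓ₁ ⊔ ℓ₂) where
    field
      left right bottom top : Carrier
      left<right : left < right
      bottom<top : bottom < top

    width : Carrier
    width = right - left

    corners : Vec (Carrier × Carrier) 4
    corners = (left , bottom) Vec.∷ (right , bottom) Vec.∷
              (right , top) Vec.∷ (left , top) Vec.∷ Vec.[]

    Contains : Carrier → Carrier → Set ℓ₂
    Contains x y = (left ≤ x × x ≤ right) × (bottom ≤ y × y ≤ top)

  open Rectangle

  Intersects : Rel Rectangle (c ⊔ ℓ₂)
  Intersects A B = ∃₂ λ x y → Contains A x y × Contains B x y

  module Overlap where
    Meet : (a b a′ b′ : Carrier) → Set (c ⊔ ℓ₂)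
    Meet a b a′ b′ = ∃ λ x → (a ≤ x × x ≤ b) × (a′ ≤ x × x ≤ b′)

    meet? : ∀ {a b a′ b′} → a ≤ b → a′ ≤ b′ → Dec (Meet a b a′ b′)
    meet? {a} {b} {a′} {b′} a≤b a′≤b′ = map′ to from ((a Order.≤? b′) ×-dec (a′ Order.≤? b))
      where
      to : a ≤ b′ × a′ ≤ b → Meet a b a′ b′
      to (p , q) with Order.total a a′
      ... | inj₁ a≤a′ = a′ , (a≤a′ , q) , (Order.refl , a′≤b′)
      ... | inj₂ a′≤a = a , (Order.refl , a≤b) , (a′≤a , p)
      from : Meet a b a′ b′ → a ≤ b′ × a′ ≤ b
      from (_ , (p , q) , (r , s)) = Order.trans p s , Order.trans r q

  intersects? : Decidable Intersects
  intersects? A B =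
    map′ (λ ((x , p , q) , (y , r , s)) → x , y , (p , r) , (q , s))
         (λ (x , y , (p , r) , (q , s)) → (x , p , q) , (y , r , s))
         (Overlap.meet? (proj₁ (left<right A)) (proj₁ (left<right B)) ×-dec
          Overlap.meet? (proj₁ (bottom<top A)) (proj₁ (bottom<top B)))

  record UnitWidthFamily (n : ℕ) : Set (c ⊔ ℓ₁ ⊔ ℓ₂) where
    field
      rect      : Fin n → Rectangle
      sameWidth : ∀ i j → width (rect i) ≈ width (rect j)

  open UnitWidthFamily

  intersectionGraph : ∀ {n} → UnitWidthFamily n → Graph n (c ⊔ ℓ₂)
  intersectionGraph R = record
    { Adj    = λ u v → u ≢ v × Intersects (rect R u) (rect R v)
    ; adj?   = λ u v → ¬? (u ≟ᶠ v) ×-dec intersects? (rect R u) (rect R v)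
    ; sym    = λ (u≢v , x , y , p , q) → (λ v≡u → u≢v (≡-sym v≡u)) , x , y , q , p
    ; irrefl = λ v (v≢v , _) → v≢v refl
    }

-- The store has natural-number and real registers, natural-number and real
-- arrays, and a write-only output tape. Registers and arrays are named by
-- literals, so that a program uses finitely many of them; only array
-- positions are computed. Real numbers influence natural numbers and control
-- flow through comparisons alone (in particular, there is no rounding).

infixl 6 _⊕_ _⊖_ _+ʳ_ _-ʳ_
infixl 7 _*ʳ_ _/ʳ_
infix  5 _≤ⁿ_ _≤ʳ_
infix  4 _≔_ _⟦_⟧≔_ _≔ʳ_ _⟦_⟧≔ʳ_
infixr 3 _⨾_

data NExp : Set where
  lit     : ℕ → NExp
  var     : ℕ → NExp
  at      : ℕ → NExp → NExp
  _⊕_ _⊖_ : NExp → NExp → NExp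

data RExp : Set where
  0ʳ 1ʳ                   : RExp
  varʳ                    : ℕ → RExp
  atʳ                     : ℕ → NExp → RExp
  _+ʳ_ _-ʳ_ _*ʳ_ _/ʳ_     : RExp → RExp → RExp

data Test : Set where
  _≤ⁿ_       : NExp → NExp → Test
  _≤ʳ_       : RExp → RExp → Test
  notᵗ       : Test → Test
  andᵗ orᵗ   : Test → Test → Test

data Program : Set where
  skip      : Program
  _≔_       : ℕ → NExp → Program
  _⟦_⟧≔_    : ℕ → NExp → NExp → Program
  _≔ʳ_      : ℕ → RExp → Program
  _⟦_⟧≔ʳ_   : ℕ → NExp → RExp → Program
  emit      : NExp → Program
  _⨾_       : Program → Program → Program
  ifᵖ       : Test → Program → Program → Program
  while     : Test → Program → Program

costⁿ : NExp → ℕ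
costⁿ (lit _)  = 1
costⁿ (var _)  = 1
costⁿ (at _ e) = 1 + costⁿ e
costⁿ (d ⊕ e)  = 1 + (costⁿ d + costⁿ e)
costⁿ (d ⊖ e)  = 1 + (costⁿ d + costⁿ e)

costʳ : RExp → ℕ
costʳ 0ʳ        = 1
costʳ 1ʳ        = 1
costʳ (varʳ _)  = 1
costʳ (atʳ _ e) = 1 + costⁿ e
costʳ (d +ʳ e)  = 1 + (costʳ d + costʳ e)
costʳ (d -ʳ e)  = 1 + (costʳ d + costʳ e)
costʳ (d *ʳ e)  = 1 + (costʳ d + costʳ e)
costʳ (d /ʳ e)  = 1 + (costʳ d + costʳ e)

costᵗ : Test → ℕ
costᵗ (d ≤ⁿ e)   = 1 + (costⁿ d + costⁿ e)
costᵗ (d ≤ʳ e)   = 1 + (costʳ d + costʳ e)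
costᵗ (notᵗ b)   = 1 + costᵗ b
costᵗ (andᵗ a b) = 1 + (costᵗ a + costᵗ b)
costᵗ (orᵗ a b)  = 1 + (costᵗ a + costᵗ b)

_[_↦_] : ∀ {a} {A : Set a} → (ℕ → A) → ℕ → A → (ℕ → A)
(f [ i ↦ x ]) j = if does (j ≟ i) then x else f j

module _ {c ℓ₁ ℓ₂} (F : OrderedField c ℓ₁ ℓ₂) where
  open OrderedField F

  record Store : Set c where
    field
      reg  : ℕ → ℕ
      arr  : ℕ → ℕ → ℕ
      regʳ : ℕ → Carrier
      arrʳ : ℕ → ℕ → Carrier
      out  : List ℕ

  open Store

  evalⁿ : Store → NExp → ℕ
  evalⁿ s (lit k)  = k
  evalⁿ s (var x)  = reg s x
  evalⁿ s (at a e) = arr s a (evalⁿ s e)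
  evalⁿ s (d ⊕ e)  = evalⁿ s d + evalⁿ s e
  evalⁿ s (d ⊖ e)  = evalⁿ s d ∸ evalⁿ s e

  evalʳ : Store → RExp → Carrier
  evalʳ s 0ʳ        = 0#
  evalʳ s 1ʳ        = 1#
  evalʳ s (varʳ x)  = regʳ s x
  evalʳ s (atʳ a e) = arrʳ s a (evalⁿ s e)
  evalʳ s (d +ʳ e)  = evalʳ s d +ᶠ evalʳ s e
  evalʳ s (d -ʳ e)  = evalʳ s d - evalʳ s e
  evalʳ s (d *ʳ e)  = evalʳ s d *ᶠ evalʳ s e
  evalʳ s (d /ʳ e)  = evalʳ s d *ᶠ (evalʳ s e ⁻¹)

  evalᵗ : Store → Test → Bool
  evalᵗ s (d ≤ⁿ e)   = evalⁿ s d ℕ.≤ᵇ evalⁿ s e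
  evalᵗ s (d ≤ʳ e)   = does (evalʳ s d Order.≤? evalʳ s e)
  evalᵗ s (notᵗ b)   = not (evalᵗ s b)
  evalᵗ s (andᵗ a b) = evalᵗ s a ∧ evalᵗ s b
  evalᵗ s (orᵗ a b)  = evalᵗ s a ∨ evalᵗ s b

  -- Run p s s′ t: started in s, the program p halts in s′ after t steps.
  data Run : Program → Store → Store → ℕ → Set c where
    run-skip : ∀ {s} → Run skip s s 1

    run-≔ : ∀ {s x e} →
      Run (x ≔ e) s (record s { reg = reg s [ x ↦ evalⁿ s e ] }) (1 + costⁿ e)

    run-⟦⟧≔ : ∀ {s a i e} →
      Run (a ⟦ i ⟧≔ e) s
          (record s { arr = arr s [ a ↦ arr s a [ evalⁿ s i ↦ evalⁿ s e ] ] })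
          (1 + (costⁿ i + costⁿ e))

    run-≔ʳ : ∀ {s x e} →
      Run (x ≔ʳ e) s (record s { regʳ = regʳ s [ x ↦ evalʳ s e ] }) (1 + costʳ e)

    run-⟦⟧≔ʳ : ∀ {s a i e} →
      Run (a ⟦ i ⟧≔ʳ e) s
          (record s { arrʳ = arrʳ s [ a ↦ arrʳ s a [ evalⁿ s i ↦ evalʳ s e ] ] })
          (1 + (costⁿ i + costʳ e))

    run-emit : ∀ {s e} →
      Run (emit e) s (record s { out = out s ∷ʳ evalⁿ s e }) (1 + costⁿ e)

    run-⨾ : ∀ {p q s s′ s″ t t′} →
      Run p s s′ t → Run q s′ s″ t′ → Run (p ⨾ q) s s″ (t + t′)

    run-if-true : ∀ {b p q s s′ t} → evalᵗ s b ≡ true →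
      Run p s s′ t → Run (ifᵖ b p q) s s′ (1 + costᵗ b + t)

    run-if-false : ∀ {b p q s s′ t} → evalᵗ s b ≡ false →
      Run q s s′ t → Run (ifᵖ b p q) s s′ (1 + costᵗ b + t)

    run-while-true : ∀ {b p s s′ s″ t t′} → evalᵗ s b ≡ true →
      Run p s s′ t → Run (while b p) s′ s″ t′ →
      Run (while b p) s s″ (1 + costᵗ b + t + t′)

    run-while-false : ∀ {b p s} → evalᵗ s b ≡ false →
      Run (while b p) s s (1 + costᵗ b)

  coordinates : Rectangle F → Vec Carrier 8
  coordinates r = Vec.concat (Vec.map (λ (x , y) → x Vec.∷ y Vec.∷ Vec.[]) (Rectangle.corners r))

  -- Register 0 holds n, and for j < 8 the real array j holds at position i
  -- the j-th corner coordinate of the i-th rectangle.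
  input : ∀ {n} → UnitWidthFamily F n → Store
  input {n} R = record
    { reg  = (λ _ → 0) [ 0 ↦ n ]
    ; arr  = λ _ _ → 0
    ; regʳ = λ _ → 0#
    ; arrʳ = coordinate
    ; out  = []
    }
    where
    coordinate : ℕ → ℕ → Carrier
    coordinate j i with j <? 8 | i <? n
    ... | yes j<8 | yes i<n = lookup (coordinates (UnitWidthFamily.rect R (fromℕ< i<n))) (fromℕ< j<8)
    ... | _       | _       = 0#

-- The tree has nodes 0, …, m and root 0, and node suc t has an earlier node
-- as its parent. Bags are given by their differences along the tree edges:
-- listing every bag in full may need quadratically many entries (n/2
-- rectangles meeting all others, together with n/2 pairwise disjoint ones).
record Description (n m : ℕ) : Set where
  field
    layerOf   : Fin n → ℕ
    parent    : Fin m → Fin (suc m)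
    parent≤   : ∀ t → toℕ (parent t) ℕ.≤ toℕ t
    forget    : Fin m → List (Fin n)
    introduce : Fin (suc m) → List (Fin n)

  Parent : Rel (Fin (suc m)) 0ℓ
  Parent s t = ∃ λ i → s ≡ parent i × t ≡ suc i

  block : List (Fin n) → List ℕ
  block vs = length vs ∷ map toℕ vs

  serialize : List ℕ
  serialize =
    tabulate layerOf ++ m ∷ block (introduce zero) ++
    concat (tabulate λ t → toℕ (parent t) ∷ block (forget t) ++ block (introduce (suc t)))

record Describes {n m ℓ} {G : Graph n ℓ} (d : Description n m)
                 (D : TreeDecomposition G (suc m)) (L : Layering G) : Set where
  open Description d
  open TreeDecomposition D
  open Layering L
  field
    layers   : ∀ v → layer v ≡ layerOf v
    edges    : ∀ s t → Graph.Adj tree s t ⇔ (Parent s t ⊎ Parent t s)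
    rootBag  : ∀ v → v ∈ bag zero ⇔ v ∈ₗ introduce zero
    childBag : ∀ t v → v ∈ bag (suc t) ⇔
                 ((v ∈ bag (parent t) × v ∉ₗ forget t) ⊎ v ∈ₗ introduce (suc t))

record Outputs {n m ℓ} {G : Graph n ℓ} (tape : List ℕ)
               (D : TreeDecomposition G (suc m)) (L : Layering G) : Set where
  field
    description : Description n m
    describes   : Describes description D L
    serialized  : tape ≡ Description.serialize description

{-# OPTIONS --safe #-}
module Submission where

-- Sweep a horizontal line upwards: the sets of rectangles that it meets are
-- the bags of a path decomposition, in which a rectangle is introduced at its
-- lower side and forgotten at its upper side, so that any two rectangles in a
-- bag overlap vertically. For the layers, scan the rectangles by their left
-- sides and open a new layer whenever the next left side lies beyond the right
-- side of the rectangle that opened the current layer. As all widths agree,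
-- the right sides occur in the same order as the left sides; hence rectangles
-- in the same layer overlap horizontally, and rectangles two or more layers
-- apart do not. Both scans only need the order of the sides, which merge sort
-- finds with O(n log n) comparisons; no arithmetic on real numbers is used.

open import Defs
open import Data.Nat using (ℕ; suc; _*_; _≤_)
open import Data.Nat.Logarithm using (⌈log₂_⌉)
open import Data.Fin.Subset using (_∩_)
open import Data.Product using (Σ; ∃; ∃₂; _×_)

open import Algebra.Bundles using (CommutativeRing)
open import Algebra.Properties.AbelianGroup using (xyx⁻¹≈y)
open import Data.Bool.Base using (Bool; true; false; not; _∧_; _∨_; if_then_else_; T)
open import Data.Bool.Properties using (T-≡; ∧-zeroʳ; ∨-identityʳ)
open import Data.Fin.Base using (Fin; zero; suc; toℕ; fromℕ; fromℕ<; inject₁; splitAt; join; _↑ˡ_; _↑ʳ_)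
open import Data.Fin.Patterns using (0F; 1F; 2F; 5F)
import Data.Fin.Properties as Finₚ
open import Data.Fin.Subset using (Subset; inside; outside; _∈_; _⊆_; ∣_∣; ⁅_⁆)
open import Data.Fin.Subset.Properties using (nonempty?; Empty-unique; ∣⊥∣≡0; ∣⁅x⁆∣≡1; x∈⁅x⁆; x∈⁅y⁆⇒x≡y; p⊆q⇒∣p∣≤∣q∣; x∈p∩q⁺; x∈p∩q⁻; _∈?_; _⊆?_)
open import Data.List.Base using (List; []; _∷_; [_]; _++_; _∷ʳ_; length; map; filter; concat; tabulate; upTo; applyUpTo)
open import Data.List.Extrema.Nat using (max≤v⁺; xs≤max)
open import Data.List.Membership.Propositional using () renaming (_∈_ to _∈ₗ_; _∉_ to _∉ₗ_)
open import Data.List.Membership.Propositional.Properties using (∈-map⁺; ∈-map⁻; ∈-++⁺ˡ; ∈-++⁺ʳ; ∈-filter⁺; ∈-filter⁻; ∈-upTo⁺)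
open import Data.List.Properties using (length-++; length-applyUpTo; ++-assoc; ++-identityʳ; tabulate-cong)
open import Data.List.Relation.Binary.Permutation.Propositional using (_↭_; ↭-refl; ↭-sym; ↭-trans; prep; ↭-reflexive; ↭⇒↭ₛ)
open import Data.List.Relation.Binary.Permutation.Propositional.Properties using (↭-length; ++⁺; shift; All-resp-↭; ∈-resp-↭; ↭-empty-inv)
import Data.List.Relation.Binary.Permutation.Setoid.Properties as Permutation
open import Data.List.Relation.Unary.All as All using (All; []; _∷_)
import Data.List.Relation.Unary.All.Properties as Allₚ
open import Data.List.Relation.Unary.AllPairs as AllPairs using (AllPairs; []; _∷_)
open import Data.List.Relation.Unary.Any using (here; there)
open import Data.List.Relation.Unary.Unique.Propositional using (Unique)
open import Data.List.Relation.Unary.Unique.Propositional.Properties using (upTo⁺)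
open import Data.Nat.Base using (zero; _+_; _∸_; _^_; _<_; _≤ᵇ_; z≤n; s≤s; ∣_-_∣; ⌊_/2⌋; ⌈_/2⌉)
open import Data.Nat.Induction using (<-rec)
open import Data.Nat.Logarithm using (⌈log₂⌉-mono-≤; ⌈log₂⌈n/2⌉⌉≡⌈log₂n⌉∸1; ⌈log₂2*n⌉≡1+⌈log₂n⌉)
open import Data.Nat.Properties
open import Data.Nat.Tactic.RingSolver using (solve-∀)
open import Data.Product.Base using (_,_; proj₁; proj₂)
open import Data.Sum.Base as Sum using (_⊎_; inj₁; inj₂; [_,_]′; swap)
import Data.Sum.Properties as Sumₚ
open import Data.Vec.Base as Vec using ()
open import Data.Vec.Properties using (lookup∘tabulate; []=⇒lookup; lookup⇒[]=)
open import Function.Base using (_∘_; id; const)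
open import Function.Bundles using (mk⇔; Equivalence)
open import Function.Definitions using (Injective)
open import Level using (Level; _⊔_; 0ℓ)
open import Relation.Binary.Construct.Closure.ReflexiveTransitive using (Star; ε; _◅_; reverse) renaming (map to map⋆)
open import Relation.Binary.PropositionalEquality using (_≡_; _≢_; refl; sym; trans; cong; cong₂; subst; subst₂; setoid)
open import Relation.Nullary using (¬_; Dec; yes; no; contradiction; does)
open import Relation.Nullary.Decidable using (_×-dec_; _⊎-dec_; ¬?; dec-true; dec-false; decidable-stable)

-- The machine cannot round, so the layers cannot be read off as the columns of a grid with cells as
-- wide as the rectangles; this is why they are chosen greedily. Layers two apart do not meet
-- because every rectangle below the current layer ends no further right than the opener of that
-- layer, and the next layer is opened by a rectangle starting beyond that end. Closed rectangles
-- that merely touch intersect, so at equal heights lower sides have to precede upper sides, while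
-- ties within either kind may fall in any order. There are 2n sides, hence 2n + 1 nodes, and
-- neighbouring bags differ by one rectangle, so the whole output is linear. The sort is bottom-up,
-- for lack of procedure calls, and each pass writes behind its input: nothing on the tape is ever
-- overwritten, so facts about it persist, and the sorted events survive the second sort. `Sweep`
-- separates the machine from the graphs: the program is only shown to produce its data, and the
-- decomposition is built from these data alone.

private variable
  k l : ℕ

-- Evaluating tests, and arrays that spell out lists

≤ᵇ-true : k ≤ l → (k ≤ᵇ l) ≡ true
≤ᵇ-true k≤l = Equivalence.to T-≡ (≤⇒≤ᵇ k≤l)

≤ᵇ-false : l < k → (k ≤ᵇ l) ≡ false
≤ᵇ-false {l} {k} l<k with k ≤ᵇ l in eq
... | false = refl
... | true  = contradiction (≤ᵇ⇒≤ k l (Equivalence.from T-≡ eq)) (<⇒≱ l<k)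

-- `A` is the cost of one round and `E` that of leaving the loop. The right side is by computation
-- `E + suc k * A`, the bound for one more round.
loop-cost : ∀ A k E → A + (E + k * A) ≡ E + (A + k * A)
loop-cost = solve-∀

module _ {a} {A : Set a} where

  ↦-same : ∀ (f : ℕ → A) i x → (f [ i ↦ x ]) i ≡ x
  ↦-same f i x rewrite dec-true (i ≟ i) refl = refl

  ↦-other : ∀ (f : ℕ → A) {i j} x → j ≢ i → (f [ i ↦ x ]) j ≡ f j
  ↦-other f {i} {j} x j≢i rewrite dec-false (j ≟ i) j≢i = refl

data Holds (f : ℕ → ℕ) (k : ℕ) : List ℕ → Set where
  []  : Holds f k []
  _∷_ : ∀ {x xs} → f k ≡ x → Holds f (suc k) xs → Holds f k (x ∷ xs)

module _ {f : ℕ → ℕ} where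

  holds-agree : ∀ {g xs} → Holds f k xs → k + length xs ≤ l →
                (∀ i → i < l → g i ≡ f i) → Holds g k xs
  holds-agree []        _ _ = []
  holds-agree {k = k} {xs = _ ∷ xs} (eq ∷ h) b agree =
    trans (agree k (≤-trans (s≤s (m≤m+n k _)) b′)) eq ∷ holds-agree h b′ agree
    where b′ = ≤-trans (≤-reflexive (sym (+-suc k (length xs)))) b

  holds-++⁺ : ∀ {xs ys} → Holds f k xs → Holds f (k + length xs) ys → Holds f k (xs ++ ys)
  holds-++⁺ {k = k} [] h′ = subst (λ i → Holds f i _) (+-identityʳ k) h′
  holds-++⁺ {k = k} {_ ∷ xs} {ys} (eq ∷ h) h′ =
    eq ∷ holds-++⁺ h (subst (λ i → Holds f i ys) (+-suc k (length xs)) h′)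

  holds-++⁻ : ∀ xs {ys} → Holds f k (xs ++ ys) → Holds f k xs × Holds f (k + length xs) ys
  holds-++⁻ {k = k} [] h = [] , subst (λ i → Holds f i _) (sym (+-identityʳ k)) h
  holds-++⁻ {k = k} (_ ∷ xs) {ys} (eq ∷ h) with h₁ , h₂ ← holds-++⁻ xs h =
    eq ∷ h₁ , subst (λ i → Holds f i ys) (sym (+-suc k (length xs))) h₂

  holds-All : ∀ {p} {P : ℕ → Set p} {xs} → Holds f k xs → All P xs →
              ∀ {i} → i < length xs → P (f (k + i))
  holds-All {k = k} {P = P} (refl ∷ h) (px ∷ _) {zero} _ = subst (P ∘ f) (sym (+-identityʳ k)) px
  holds-All {k = k} {P = P} (_ ∷ h) (_ ∷ pxs) {suc i} (s≤s i<) =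
    subst (P ∘ f) (sym (+-suc k i)) (holds-All h pxs i<)

  holds-∈ : ∀ {x xs} → Holds f k xs → x ∈ₗ xs → ∃ λ i → i < length xs × f (k + i) ≡ x
  holds-∈ {k = k} (eq ∷ h) (here refl) = 0 , s≤s z≤n , trans (cong f (+-identityʳ k)) eq
  holds-∈ {k = k} (eq ∷ h) (there x∈) with i , i< , eq′ ← holds-∈ h x∈ =
    suc i , s≤s i< , trans (cong f (+-suc k i)) eq′

  holds-AllPairs : ∀ {r} {R : ℕ → ℕ → Set r} {xs} → Holds f k xs → AllPairs R xs →
                   ∀ {i j} → i < j → j < length xs → R (f (k + i)) (f (k + j))
  holds-AllPairs {k = k} {R = R} (refl ∷ h) (r ∷ _) {zero} {suc j} _ (s≤s j<)
    rewrite +-identityʳ k | +-suc k j = holds-All h r j<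
  holds-AllPairs {k = k} (_ ∷ h) (_ ∷ rs) {suc i} {suc j} (s≤s i<j) (s≤s j<)
    rewrite +-suc k i | +-suc k j = holds-AllPairs h rs i<j j<

-- A program logic with time bounds

straight : Program → Bool
straight (ifᵖ _ _ _) = false
straight (while _ _) = false
straight (p ⨾ p′)    = straight p ∧ straight p′
straight _           = true

-- price and (below) effect are junk on programs that are not straight.
price : Program → ℕ
price skip          = 1
price (x ≔ e)       = 1 + costⁿ e
price (a ⟦ i ⟧≔ e)  = 1 + (costⁿ i + costⁿ e)
price (x ≔ʳ e)      = 1 + costʳ e
price (a ⟦ i ⟧≔ʳ e) = 1 + (costⁿ i + costʳ e)
price (emit e)      = 1 + costⁿ e
price (p ⨾ p′)      = price p + price p′
price _             = 0

module Machine {c ℓ₁ ℓ₂} (F : OrderedField c ℓ₁ ℓ₂) where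
  open OrderedField F using (Carrier)
  open Store public

  -- A total-correctness triple for one initial store. The exact step count is replaced by an upper
  -- bound so that different runs of the same program can share it.
  record Exec {q} (p : Program) (s : Store F) (bound : ℕ) (Q : Store F → Set q) : Set (c ⊔ q) where
    constructor exec
    field
      {final} : Store F
      {steps} : ℕ
      run     : Run F p s final steps
      within  : steps ≤ bound
      post    : Q final

  private variable
    q q′  : Level
    Q Q′  : Store F → Set q
    p p′  : Program
    b     : Test
    s     : Store F
    B B′  : ℕ

  within-≤ : B ≤ B′ → Exec p s B Q → Exec p s B′ Q
  within-≤ B≤ (exec r w x) = exec r (≤-trans w B≤) x

  map-post : (∀ {s} → Q s → Q′ s) → Exec p s B Q → Exec p s B Q′
  map-post f (exec r w x) = exec r w (f x)

  infixr 3 _then_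
  _then_ : Exec p s B Q → (∀ {s′} → Q s′ → Exec p′ s′ B′ Q′) → Exec (p ⨾ p′) s (B + B′) Q′
  exec r w x then f with exec r′ w′ y ← f x = exec (run-⨾ r r′) (+-mono-≤ w w′) y

  -- The sum of both branches serves as their common bound; unlike the maximum, it keeps all cost
  -- equations within reach of the ring solver.
  if-true : evalᵗ F s b ≡ true → Exec p s B Q →
            Exec (ifᵖ b p p′) s (1 + costᵗ b + (B + B′)) Q
  if-true {b = b} {B′ = B′} eq (exec r w x) =
    exec (run-if-true eq r) (+-monoʳ-≤ (1 + costᵗ b) (≤-trans w (m≤m+n _ B′))) x

  if-false : evalᵗ F s b ≡ false → Exec p′ s B′ Q →
             Exec (ifᵖ b p p′) s (1 + costᵗ b + (B + B′)) Q
  if-false {b = b} {B = B} eq (exec r w x) =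
    exec (run-if-false eq r) (+-monoʳ-≤ (1 + costᵗ b) (≤-trans w (m≤n+m _ B))) x

  -- The postcondition of the body is that the remaining loop runs. Loops are thus verified by
  -- recursion on the data that they consume, without a separate invariant rule.
  while-true : evalᵗ F s b ≡ true → Exec p s B (λ s′ → Exec (while b p) s′ B′ Q) →
               Exec (while b p) s (1 + costᵗ b + B + B′) Q
  while-true {b = b} eq (exec r w (exec r′ w′ x)) =
    exec (run-while-true eq r r′) (+-mono-≤ (+-monoʳ-≤ (1 + costᵗ b) w) w′) x

  while-false : evalᵗ F s b ≡ false → Q s → Exec (while b p) s (1 + costᵗ b) Q
  while-false eq x = exec (run-while-false eq) ≤-refl x

  effect : Program → Store F → Store F
  effect (x ≔ e)        s = record s { reg = reg s [ x ↦ evalⁿ F s e ] }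
  effect (a ⟦ i ⟧≔ e)   s = record s { arr = arr s [ a ↦ arr s a [ evalⁿ F s i ↦ evalⁿ F s e ] ] }
  effect (x ≔ʳ e)       s = record s { regʳ = regʳ s [ x ↦ evalʳ F s e ] }
  effect (a ⟦ i ⟧≔ʳ e)  s = record s { arrʳ = arrʳ s [ a ↦ arrʳ s a [ evalⁿ F s i ↦ evalʳ F s e ] ] }
  effect (emit e)       s = record s { out = out s ∷ʳ evalⁿ F s e }
  effect (p ⨾ p′)       s = effect p′ (effect p s)
  effect _              s = s

  run-straight : ∀ p s → T (straight p) → Run F p s (effect p s) (price p)
  run-straight skip           s _ = run-skip
  run-straight (x ≔ e)        s _ = run-≔
  run-straight (a ⟦ i ⟧≔ e)   s _ = run-⟦⟧≔
  run-straight (x ≔ʳ e)       s _ = run-≔ʳ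
  run-straight (a ⟦ i ⟧≔ʳ e)  s _ = run-⟦⟧≔ʳ
  run-straight (emit e)       s _ = run-emit
  run-straight (p ⨾ p′)       s t with straight p in eq
  ... | true = run-⨾ (run-straight p s (Equivalence.from T-≡ eq)) (run-straight p′ (effect p s) t)

  -- On a concrete block `T (straight p)` computes to the unit type, so the implicit argument is
  -- filled in automatically and only the computed final store remains to be examined.
  line : ∀ p {_ : T (straight p)} → Q (effect p s) → Exec p s (price p) Q
  line p {t} x = exec (run-straight p _ t) ≤-refl x

  line-then : ∀ p {_ : T (straight p)} → Exec p′ (effect p s) B′ Q → Exec (p ⨾ p′) s (price p + B′) Q
  line-then p {t} x = exec (run-straight p _ t) ≤-refl x then id

  -- The part of the store that sorting leaves unchanged.
  record Context : Set c where
    constructor context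
    field
      reg0 reg3 reg10 : ℕ
      arr1            : ℕ → ℕ
      reals           : ℕ → ℕ → Carrier
      output          : List ℕ

  contextOf : Store F → Context
  contextOf s = context (reg s 0) (reg s 3) (reg s 10) (arr s 1) (arrʳ s) (out s)

  -- Array 0 is a tape on which new entries are only ever written at the
  -- position held by register 2; here this position moves from k to k′ while
  -- the tape changes from f to f′.
  record Appended (k : ℕ) (f : ℕ → ℕ) (k′ : ℕ) (f′ : ℕ → ℕ) (xs : List ℕ) : Set where
    field
      end   : k′ ≡ k + length xs
      holds : Holds f′ k xs
      below : ∀ i → i < k → f′ i ≡ f i

  open Appended public

  Appends : Store F → Store F → List ℕ → Set
  Appends s s′ = Appended (reg s 2) (arr s 0) (reg s′ 2) (arr s′ 0)

  private variable
    k′ k″ i   : ℕ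
    f f′ f″   : ℕ → ℕ
    xs ys     : List ℕ

  appended-[] : Appended k f k f []
  appended-[] = record { end = sym (+-identityʳ _) ; holds = [] ; below = λ _ _ → refl }

  appended-≤ : Appended k f k′ f′ xs → k ≤ k′
  appended-≤ A = ≤-trans (m≤m+n _ _) (≤-reflexive (sym (end A)))

  appended-++ : Appended k f k′ f′ xs → Appended k′ f′ k″ f″ ys → Appended k f k″ f″ (xs ++ ys)
  appended-++ {k = k} {xs = xs} {f″ = f″} {ys = ys} A B = record
    { end   = trans (end B) (trans (cong (_+ length ys) (end A))
                (trans (+-assoc k _ _) (cong (k +_) (sym (length-++ xs)))))
    ; holds = holds-++⁺ (holds-agree (holds A) (≤-reflexive (sym (end A))) (below B))
                        (subst (λ i → Holds f″ i ys) (end A) (holds B))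
    ; below = λ i i< → trans (below B i (≤-trans i< (appended-≤ A))) (below A i i<)
    }

  appended-keeps : Appended k f k′ f′ xs → Holds f i ys → i + length ys ≤ k → Holds f′ i ys
  appended-keeps A h b = holds-agree h b (below A)

  appended-entry : ∀ {x y} → x ≡ y → Appended k f (suc k) (f [ k ↦ x ]) [ y ]
  appended-entry {k = k} {f = f} {x} refl = record
    { end   = +-comm 1 k
    ; holds = ↦-same f k x ∷ []
    ; below = λ i i< → ↦-other f x (<⇒≢ i<)
    }

-- Merge sort

copyLeft copyRight : Program
copyLeft  = 0 ⟦ var 2 ⟧≔ at 0 (var 6) ⨾ 6 ≔ lit 1 ⊕ var 6 ⨾ 2 ≔ lit 1 ⊕ var 2
copyRight = 0 ⟦ var 2 ⟧≔ at 0 (var 8) ⨾ 8 ≔ lit 1 ⊕ var 8 ⨾ 2 ≔ lit 1 ⊕ var 2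

-- Truncated subtraction gives minima: a ∸ (a ∸ b) = min a b. With w in
-- register 4 and the end of the tape in register 5, this cuts off the next
-- two runs of length w, the last of which may be shorter.
runSetup : Program
runSetup = 7 ≔ var 5 ⊖ (var 5 ⊖ (var 6 ⊕ var 4)) ⨾ 8 ≔ var 7 ⨾
           9 ≔ var 5 ⊖ (var 5 ⊖ (var 7 ⊕ var 4))

-- Register 1 marks the start of the list to be sorted and register 3 holds its length. A pass fixes
-- the end of its input in register 5 and moves register 1 to the write position, where its own
-- output will begin.
passSetup advance double fillSetup fillBody : Program
passSetup = 5 ≔ var 2 ⨾ 6 ≔ var 1 ⨾ 1 ≔ var 2
advance   = 6 ≔ var 9
double    = 4 ≔ var 4 ⊕ var 4
fillSetup = 1 ≔ var 2 ⨾ 6 ≔ lit 0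
fillBody  = 0 ⟦ var 2 ⟧≔ var 6 ⨾ 6 ≔ lit 1 ⊕ var 6 ⨾ 2 ≔ lit 1 ⊕ var 2

passTest sortTest fillTest : Test
passTest = notᵗ (var 5 ≤ⁿ var 6)
sortTest = notᵗ (var 3 ≤ⁿ var 4)
fillTest = notᵗ (var 3 ≤ⁿ var 6)

-- The tape holds the two runs to be merged at positions reg 6, …, reg 7 - 1
-- and reg 8, …, reg 9 - 1.
mergeTest : Test
mergeTest = notᵗ (andᵗ (var 7 ≤ⁿ var 6) (var 9 ≤ⁿ var 8))

-- Bounds the number of passes, each of which doubles the length of the runs. The induction goes
-- through `⌈ n /2⌉`, whose logarithm is smaller by one.
n≤2^⌈log₂n⌉ : ∀ n → n ≤ 2 ^ ⌈log₂ n ⌉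
n≤2^⌈log₂n⌉ = <-rec _ bound
  where
  bound : ∀ n → (∀ {m} → m < n → m ≤ 2 ^ ⌈log₂ m ⌉) → n ≤ 2 ^ ⌈log₂ n ⌉
  bound zero                _   = z≤n
  bound (suc zero)          _   = s≤s z≤n
  bound n@(suc (suc n′)) rec = begin
    n                                       ≡⟨ ⌊n/2⌋+⌈n/2⌉≡n n ⟨
    ⌊ n /2⌋ + ⌈ n /2⌉                       ≤⟨ +-monoˡ-≤ ⌈ n /2⌉ (⌊n/2⌋≤⌈n/2⌉ n) ⟩
    ⌈ n /2⌉ + ⌈ n /2⌉                       ≤⟨ +-mono-≤ half half ⟩
    2 ^ d + 2 ^ d                           ≡⟨ cong (2 ^ d +_) (+-identityʳ (2 ^ d)) ⟨
    2 ^ suc d                               ≡⟨ cong (λ k → 2 ^ suc k) (⌈log₂⌈n/2⌉⌉≡⌈log₂n⌉∸1 n) ⟩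
    2 ^ ⌈log₂ n ⌉                           ∎
    where
    open ≤-Reasoning
    d = ⌈log₂ ⌈ n /2⌉ ⌉
    half = rec (⌈n/2⌉<n n′)

-- Here `rest` is what follows the run on the tape: only the last run may fall short of `w`.
Fits : ℕ → List ℕ → List ℕ → Set
Fits w xs rest = length xs ≡ w ⊎ (length xs ≤ w × rest ≡ [])

-- The left side is the minimum of `e` and `i + w`. A full run ends at `i + w`, which does not
-- exceed `e`; a short one is the last and ends at `e`.
clip : ∀ {w} xs {rest} i {e} → Fits w xs rest → e ≡ i + length (xs ++ rest) →
       e ∸ (e ∸ (i + w)) ≡ i + length xs
clip {w} xs i (inj₁ refl) refl =
  m∸[m∸n]≡n (+-monoʳ-≤ i (≤-trans (m≤m+n w _) (≤-reflexive (sym (length-++ xs)))))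
clip xs i (inj₂ (xs≤w , refl)) refl rewrite ++-identityʳ xs =
  cong (i + length xs ∸_) (m≤n⇒m∸n≡0 (+-monoʳ-≤ i xs≤w))

fits-≤ : ∀ {w xs rest} → Fits w xs rest → length xs ≤ w
fits-≤ (inj₁ eq)       = ≤-reflexive eq
fits-≤ (inj₂ (le , _)) = le

fits-merge : ∀ {w} xs ys {rs} {zs zs′} → 0 < w → Fits w xs (ys ++ rs) → Fits w ys rs →
             zs ↭ xs ++ ys → zs′ ↭ rs → Fits (w + w) zs zs′
fits-merge xs ys _ (inj₁ ex) (inj₁ ey) p _ =
  inj₁ (trans (↭-length p) (trans (length-++ xs) (cong₂ _+_ ex ey)))
-- Nothing follows a short first run, so the second run is empty and cannot have the full length
-- `w`, which is positive.
fits-merge xs [] 0<w (inj₂ _) (inj₁ refl) _ _ = contradiction 0<w λ ()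
fits-merge xs ys _ fx (inj₂ (ly , refl)) p p′ =
  inj₂ (≤-trans (≤-reflexive (trans (↭-length p) (length-++ xs))) (+-mono-≤ (fits-≤ {xs = xs} fx) ly)
       , ↭-empty-inv p′)

-- The comparison is a schema of tests because the machine has no procedures: the program contains
-- two instances of this code, one for each order.
module SortProgram (compare : NExp → NExp → Test) where

  -- Evaluation is total, so reading past the end of an exhausted run does no harm: the two
  -- conditions on the positions then decide the test alone.
  takeLeft : Test
  takeLeft = orᵗ (var 9 ≤ⁿ var 8)
                 (andᵗ (notᵗ (var 7 ≤ⁿ var 6)) (compare (at 0 (var 6)) (at 0 (var 8))))

  merge : Program
  merge = while mergeTest (ifᵖ takeLeft copyLeft copyRight)

  mergeStep mergeExit : ℕ
  mergeStep = 1 + costᵗ mergeTest + (1 + costᵗ takeLeft + (price copyLeft + price copyRight))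
  mergeExit = 1 + costᵗ mergeTest

  pass : Program
  pass = while passTest (runSetup ⨾ merge ⨾ advance)

  -- The overhead of merging a pair of runs is charged to every element of the pair. A pair contains
  -- at least one element, so `passStep` per element is enough for every length of the runs.
  passExit passOverhead passStep : ℕ
  passExit     = 1 + costᵗ passTest
  passOverhead = 1 + costᵗ passTest + (price runSetup + (mergeExit + price advance))
  passStep     = mergeStep + passOverhead

  passes : Program
  passes = while sortTest (passSetup ⨾ pass ⨾ double)

  passesExit passesOverhead : ℕ
  passesExit     = 1 + costᵗ sortTest
  passesOverhead = 1 + costᵗ sortTest + (price passSetup + (passExit + price double))

  fill : Program
  fill = while fillTest fillBody

  fillExit fillStep : ℕ
  fillExit = 1 + costᵗ fillTest
  fillStep = 1 + costᵗ fillTest + price fillBody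

  sort : Program
  sort = fillSetup ⨾ fill ⨾ 4 ≔ lit 1 ⨾ passes

  sortCost : ℕ → ℕ
  sortCost n = price fillSetup + ((fillExit + n * fillStep) +
                 (2 + (passesExit + ⌈log₂ n ⌉ * (passesOverhead + n * passStep))))

-- Correctness of the sort

module Sorting {c ℓ₁ ℓ₂ r} (F : OrderedField c ℓ₁ ℓ₂) (compare : NExp → NExp → Test)
    (_⊑_ : ℕ → ℕ → Set r) (_⊑?_ : ∀ x y → Dec (x ⊑ y))
    (⊑-total : ∀ x y → x ⊑ y ⊎ y ⊑ x)
    (⊑-trans : ∀ {x y z} → x ⊑ y → y ⊑ z → x ⊑ z)
    where
  open Machine F
  open SortProgram compare

  -- The test has to decide the order only in stores with context `φ`, since its value depends on
  -- the coordinate arrays and on register 0, which the sort preserves.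
  module _ {φ : Context}
      (compare-⊑ : ∀ s → contextOf s ≡ φ → ∀ d e →
                   evalᵗ F s (compare d e) ≡ does (evalⁿ F s d ⊑? evalⁿ F s e)) where

    -- Through `left-below` and `right-below` both runs stay under the write position, so appending
    -- does not destroy what is still to be read.
    record MergeReady (xs ys : List ℕ) (s : Store F) : Set c where
      field
        left-holds  : Holds (arr s 0) (reg s 6) xs
        left-end    : reg s 7 ≡ reg s 6 + length xs
        left-below  : reg s 7 ≤ reg s 2
        right-holds : Holds (arr s 0) (reg s 8) ys
        right-end   : reg s 9 ≡ reg s 8 + length ys
        right-below : reg s 9 ≤ reg s 2
        ctx         : contextOf s ≡ φ

    record Merged (s : Store F) (xs ys : List ℕ) (s′ : Store F) : Set (c ⊔ r) where
      field
        zs       : List ℕ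
        appended : Appends s s′ zs
        perm     : zs ↭ xs ++ ys
        sorted   : AllPairs _⊑_ zs
        regs     : (reg s′ 1 , reg s′ 4 , reg s′ 5 , reg s′ 9) ≡ (reg s 1 , reg s 4 , reg s 5 , reg s 9)
        ctx      : contextOf s′ ≡ φ

    private
      nonempty-end : ∀ {i j} (x : ℕ) xs → j ≡ i + length (x ∷ xs) → i < j
      nonempty-end {i} x xs eq = ≤-trans (s≤s (m≤m+n i (length xs))) (≤-reflexive (sym (trans eq (+-suc i _))))

      shift-end : ∀ {i j} (x : ℕ) xs → j ≡ i + length (x ∷ xs) → j ≡ suc i + length xs
      shift-end {i} x xs eq = trans eq (+-suc i _)

    module _ {x xs ys s} (R : MergeReady (x ∷ xs) ys s) where
      open MergeReady R
      takeLeft-ready : MergeReady xs ys (effect copyLeft s)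
      takeLeft-appended : Appends s (effect copyLeft s) [ x ]
      takeLeft-appended with left-holds
      ... | eq ∷ _ = appended-entry eq
      takeLeft-ready with left-holds
      ... | eq ∷ h = record
        { left-holds  = appended-keeps takeLeft-appended h (≤-trans (≤-reflexive (sym (shift-end x xs left-end))) left-below)
        ; left-end    = shift-end x xs left-end
        ; left-below  = m≤n⇒m≤1+n left-below
        ; right-holds = appended-keeps takeLeft-appended right-holds (≤-trans (≤-reflexive (sym right-end)) right-below)
        ; right-end   = right-end
        ; right-below = m≤n⇒m≤1+n right-below
        ; ctx         = ctx
        }

    module _ {xs y ys s} (R : MergeReady xs (y ∷ ys) s) where
      open MergeReady R
      takeRight-ready : MergeReady xs ys (effect copyRight s)
      takeRight-appended : Appends s (effect copyRight s) [ y ]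
      takeRight-appended with right-holds
      ... | eq ∷ _ = appended-entry eq
      takeRight-ready with right-holds
      ... | eq ∷ h = record
        { left-holds  = appended-keeps takeRight-appended left-holds (≤-trans (≤-reflexive (sym left-end)) left-below)
        ; left-end    = left-end
        ; left-below  = m≤n⇒m≤1+n left-below
        ; right-holds = appended-keeps takeRight-appended h (≤-trans (≤-reflexive (sym (shift-end y ys right-end))) right-below)
        ; right-end   = shift-end y ys right-end
        ; right-below = m≤n⇒m≤1+n right-below
        ; ctx         = ctx
        }

    merged-left : ∀ {x xs ys s s′} (R : MergeReady (x ∷ xs) ys s) → All (x ⊑_) (xs ++ ys) →
                  Merged (effect copyLeft s) xs ys s′ → Merged s (x ∷ xs) ys s′
    merged-left {x} R x⊑ M = record
      { zs = x ∷ zs ; appended = appended-++ (takeLeft-appended R) appended ; perm = prep x perm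
      ; sorted = All-resp-↭ (↭-sym perm) x⊑ ∷ sorted ; regs = regs ; ctx = ctx }
      where open Merged M

    merged-right : ∀ {xs y ys s s′} (R : MergeReady xs (y ∷ ys) s) → All (y ⊑_) (xs ++ ys) →
                   Merged (effect copyRight s) xs ys s′ → Merged s xs (y ∷ ys) s′
    merged-right {xs} {y} {ys} R y⊑ M = record
      { zs = y ∷ zs ; appended = appended-++ (takeRight-appended R) appended
      ; perm = ↭-trans (prep y perm) (↭-sym (shift y xs ys))
      ; sorted = All-resp-↭ (↭-sym perm) y⊑ ∷ sorted ; regs = regs ; ctx = ctx }
      where open Merged M

    MergeExec : Store F → List ℕ → List ℕ → Set (c ⊔ r)
    MergeExec s xs ys =
      Exec merge s (mergeExit + (length xs + length ys) * mergeStep) (Merged s xs ys)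

    merge-left : ∀ x xs ys {s} → All (x ⊑_) xs → All (x ⊑_) ys →
                 MergeReady (x ∷ xs) ys s → evalᵗ F s takeLeft ≡ true →
                 MergeExec (effect copyLeft s) xs ys → MergeExec s (x ∷ xs) ys
    merge-left x xs ys {s} x⊑ x⊑ys R eq rest =
      within-≤ (≤-reflexive (loop-cost mergeStep (length xs + length ys) mergeExit))
        (while-true {s = s} {b = mergeTest}
          (cong (λ b → not (b ∧ (reg s 9 ≤ᵇ reg s 8))) (≤ᵇ-false (nonempty-end x xs (MergeReady.left-end R))))
          (if-true eq (line copyLeft (map-post (merged-left R (Allₚ.++⁺ x⊑ x⊑ys)) rest))))

    merge-right : ∀ xs y ys {s} → All (y ⊑_) ys → All (y ⊑_) xs →
                  MergeReady xs (y ∷ ys) s → evalᵗ F s takeLeft ≡ false →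
                  MergeExec (effect copyRight s) xs ys → MergeExec s xs (y ∷ ys)
    merge-right xs y ys {s} y⊑ y⊑xs R eq rest =
      within-≤ (≤-reflexive (trans (loop-cost mergeStep (length xs + length ys) mergeExit)
                 (cong (λ l → mergeExit + l * mergeStep) (sym (+-suc (length xs) (length ys))))))
        (while-true {s = s} {b = mergeTest}
          (cong not (trans (cong ((reg s 7 ≤ᵇ reg s 6) ∧_) (≤ᵇ-false (nonempty-end y ys (MergeReady.right-end R)))) (∧-zeroʳ _)))
          (if-false {B = price copyLeft} eq
            (line copyRight (map-post (merged-right R (Allₚ.++⁺ y⊑xs y⊑)) rest))))

    merge-compare : ∀ x xs y ys {s} → All (x ⊑_) xs → All (y ⊑_) ys → MergeReady (x ∷ xs) (y ∷ ys) s →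
                    MergeExec (effect copyLeft s) xs (y ∷ ys) →
                    MergeExec (effect copyRight s) (x ∷ xs) ys →
                    MergeExec s (x ∷ xs) (y ∷ ys)
    merge-compare x xs y ys {s} x⊑ y⊑ R restˡ restʳ = by-comparison (x ⊑? y) refl
      where
      open MergeReady R
      head-eq : ∀ {f i z zs} → Holds f i (z ∷ zs) → f i ≡ z
      head-eq (eq ∷ _) = eq
      test : evalᵗ F s takeLeft ≡ does (x ⊑? y)
      test = trans
        (cong₂ (λ a b → a ∨ (not b ∧ evalᵗ F s (compare (at 0 (var 6)) (at 0 (var 8)))))
               (≤ᵇ-false (nonempty-end y ys right-end)) (≤ᵇ-false (nonempty-end x xs left-end)))
        (trans (compare-⊑ s ctx (at 0 (var 6)) (at 0 (var 8)))
               (cong₂ (λ x y → does (x ⊑? y)) (head-eq left-holds) (head-eq right-holds)))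
      -- The decision comes with an equation for its Boolean, so that matching on it also settles
      -- the value of the test.
      by-comparison : (x⊑?y : Dec (x ⊑ y)) → does (x ⊑? y) ≡ does x⊑?y → MergeExec s (x ∷ xs) (y ∷ ys)
      by-comparison (yes x⊑y) eq =
        merge-left x xs (y ∷ ys) x⊑ (x⊑y ∷ All.map (⊑-trans x⊑y) y⊑) R (trans test eq) restˡ
      by-comparison (no x⋢y) eq =
        merge-right (x ∷ xs) y ys y⊑ (y⊑x ∷ All.map (⊑-trans y⊑x) x⊑) R (trans test eq) restʳ
        where y⊑x = [ (λ x⊑y → contradiction x⊑y x⋢y) , id ]′ (⊑-total x y)

    merge-correct : ∀ xs ys {s} → AllPairs _⊑_ xs → AllPairs _⊑_ ys → MergeReady xs ys s →
                    MergeExec s xs ys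
    merge-correct [] [] {s} _ _ R =
      within-≤ (≤-reflexive (sym (+-identityʳ mergeExit))) (while-false {b = mergeTest}
        (cong not (cong₂ _∧_ (≤ᵇ-true (≤-reflexive (trans left-end (+-identityʳ _))))
                             (≤ᵇ-true (≤-reflexive (trans right-end (+-identityʳ _))))))
        (record { zs = [] ; appended = appended-[]
                ; perm = ↭-refl ; sorted = [] ; regs = refl ; ctx = ctx }))
      where open MergeReady R
    merge-correct (x ∷ xs) [] {s} (x⊑ ∷ sx) sy R =
      merge-left x xs [] x⊑ [] R
        (cong (λ b → b ∨ (not (reg s 7 ≤ᵇ reg s 6) ∧ evalᵗ F s (compare (at 0 (var 6)) (at 0 (var 8)))))
              (≤ᵇ-true (≤-reflexive (trans right-end (+-identityʳ _)))))
        (merge-correct xs [] sx sy (takeLeft-ready R))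
      where open MergeReady R
    merge-correct [] (y ∷ ys) {s} sx (y⊑ ∷ sy) R =
      merge-right [] y ys y⊑ [] R
        (cong₂ (λ a b → a ∨ (not b ∧ evalᵗ F s (compare (at 0 (var 6)) (at 0 (var 8)))))
               (≤ᵇ-false (nonempty-end y ys right-end))
               (≤ᵇ-true (≤-reflexive (trans left-end (+-identityʳ _)))))
        (merge-correct [] ys sx sy (takeRight-ready R))
      where open MergeReady R
    merge-correct (x ∷ xs) (y ∷ ys) sx@(x⊑ ∷ sxs) sy@(y⊑ ∷ sys) R =
      merge-compare x xs y ys x⊑ y⊑ R
        (merge-correct xs (y ∷ ys) sxs sy (takeLeft-ready R))
        (merge-correct (x ∷ xs) ys sx sys (takeRight-ready R))

    data Runs (w : ℕ) : List ℕ → Set r where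
      []  : Runs w []
      run : ∀ {xs ys} → 0 < length xs → Fits w xs ys → AllPairs _⊑_ xs → Runs w ys → Runs w (xs ++ ys)

    -- A second run could only follow a full one and would push the length beyond `w`; hence there
    -- is at most one run.
    runs-sorted : ∀ {w xs} → length xs ≤ w → Runs w xs → AllPairs _⊑_ xs
    runs-sorted _ [] = []
    runs-sorted _ (run {xs} _ (inj₂ (_ , refl)) sx _) = subst (AllPairs _⊑_) (sym (++-identityʳ xs)) sx
    runs-sorted _ (run {xs} {[]} _ (inj₁ _) sx _) = subst (AllPairs _⊑_) (sym (++-identityʳ xs)) sx
    runs-sorted le (run {xs} {y ∷ ys} _ (inj₁ refl) _ _) =
      contradiction (≤-trans (≤-reflexive (sym (length-++ xs))) le) (m+1+n≰m (length xs))

    runs-singletons : ∀ xs → Runs 1 xs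
    runs-singletons []       = []
    runs-singletons (x ∷ xs) = run {xs = [ x ]} (s≤s z≤n) (inj₁ refl) ([] ∷ []) (runs-singletons xs)

    record PassReady (w : ℕ) (xs : List ℕ) (s : Store F) : Set c where
      field
        in-holds : Holds (arr s 0) (reg s 6) xs
        in-end   : reg s 5 ≡ reg s 6 + length xs
        in-below : reg s 5 ≤ reg s 2
        width    : reg s 4 ≡ w
        ctx      : contextOf s ≡ φ

    record Passed (w : ℕ) (xs : List ℕ) (s s′ : Store F) : Set (c ⊔ r) where
      field
        zs       : List ℕ
        appended : Appends s s′ zs
        perm     : zs ↭ xs
        runs     : Runs (w + w) zs
        regs     : (reg s′ 1 , reg s′ 4) ≡ (reg s 1 , reg s 4)
        ctx      : contextOf s′ ≡ φ

    PassExec : ℕ → List ℕ → Store F → Set (c ⊔ r)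
    PassExec w xs s = Exec pass s (passExit + length xs * passStep) (Passed w xs s)

    private
      pass-cost : ∀ a y r M E A B X P → let O = A + (B + (X + P)) in
        A + (B + ((X + (suc a + y) * M) + P)) + (E + r * (M + O)) + (a + y) * O
          ≡ E + (suc a + (y + r)) * (M + O)
      pass-cost = solve-∀

    -- The remainder of the pass is a hypothesis, so that the recursion takes place in
    -- `pass-correct`, where it is structural in the derivation of `Runs`.
    pass-pair : ∀ {w} xs ys rs {s} → 0 < w → 0 < length xs → Fits w xs (ys ++ rs) → Fits w ys rs →
                AllPairs _⊑_ xs → AllPairs _⊑_ ys → PassReady w (xs ++ (ys ++ rs)) s →
                (∀ {s′} → PassReady w rs s′ → PassExec w rs s′) →
                PassExec w (xs ++ (ys ++ rs)) s
    pass-pair {w} xs@(x ∷ xs′) ys rs {s} 0<w 0<xs fx fy sx sy R rest =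
      within-≤ bound (while-true {s = s} {b = passTest}
        (cong not (≤ᵇ-false (≤-trans (s≤s (m≤m+n (reg s 6) _)) (≤-reflexive (sym (trans in-end (+-suc (reg s 6) _)))))))
        (line-then runSetup (merge-correct xs ys sx sy ready then λ M → line advance
          (map-post (combine M) (rest (next M))))))
      where
      open PassReady R
      s₁ = effect runSetup s

      mid : reg s₁ 7 ≡ reg s 6 + length xs
      mid = trans (cong (λ w → reg s 5 ∸ (reg s 5 ∸ (reg s 6 + w))) width) (clip xs _ fx in-end)

      in-end′ : reg s 5 ≡ reg s₁ 7 + length (ys ++ rs)
      in-end′ = trans in-end (trans (cong (reg s 6 +_) (length-++ xs))
                  (trans (sym (+-assoc (reg s 6) _ _)) (cong (_+ length (ys ++ rs)) (sym mid))))

      hi : reg s₁ 9 ≡ reg s₁ 7 + length ys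
      hi = trans (cong (λ w → reg s 5 ∸ (reg s 5 ∸ (reg s₁ 7 + w))) width) (clip ys (reg s₁ 7) fy in-end′)

      in-end″ : reg s 5 ≡ reg s₁ 9 + length rs
      in-end″ = trans in-end′ (trans (cong (reg s₁ 7 +_) (length-++ ys))
                  (trans (sym (+-assoc (reg s₁ 7) _ _)) (cong (_+ length rs) (sym hi))))

      holds-xs = proj₁ (holds-++⁻ xs in-holds)
      holds-ys-rs : Holds (arr s 0) (reg s₁ 7) (ys ++ rs)
      holds-ys-rs = subst (λ i → Holds (arr s 0) i (ys ++ rs)) (sym mid) (proj₂ (holds-++⁻ xs in-holds))
      holds-ys = proj₁ (holds-++⁻ ys holds-ys-rs)
      holds-rs : Holds (arr s 0) (reg s₁ 9) rs
      holds-rs = subst (λ i → Holds (arr s 0) i rs) (sym hi) (proj₂ (holds-++⁻ ys holds-ys-rs))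

      ready : MergeReady xs ys s₁
      ready = record
        { left-holds = holds-xs ; left-end = mid
        ; left-below = ≤-trans (≤-trans (m≤m+n _ _) (≤-reflexive (sym in-end′))) in-below
        ; right-holds = holds-ys ; right-end = hi
        ; right-below = ≤-trans (≤-trans (m≤m+n _ _) (≤-reflexive (sym in-end″))) in-below
        ; ctx = ctx }

      module _ {s₂} (M : Merged s₁ xs ys s₂) where
        private module M = Merged M
        s₃ = effect advance s₂

        next : PassReady w rs s₃
        next = record
          { in-holds = subst (λ i → Holds (arr s₂ 0) i rs) (sym hi₂)
                         (appended-keeps M.appended holds-rs (≤-trans (≤-reflexive (sym in-end″)) in-below))
          ; in-end   = trans end₂ (trans in-end″ (cong (_+ length rs) (sym hi₂)))
          ; in-below = ≤-trans (≤-reflexive end₂) (≤-trans in-below (appended-≤ M.appended))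
          ; width    = trans (cong (proj₁ ∘ proj₂) M.regs) width
          ; ctx      = M.ctx }
          where
          end₂ : reg s₂ 5 ≡ reg s 5
          end₂ = cong (proj₁ ∘ proj₂ ∘ proj₂) M.regs
          hi₂ : reg s₂ 9 ≡ reg s₁ 9
          hi₂ = cong (proj₂ ∘ proj₂ ∘ proj₂) M.regs

        combine : ∀ {s₄} → Passed w rs s₃ s₄ → Passed w (xs ++ (ys ++ rs)) s s₄
        combine N = record
          { zs       = M.zs ++ N.zs
          ; appended = appended-++ M.appended N.appended
          ; perm     = ↭-trans (++⁺ M.perm N.perm) (↭-reflexive (++-assoc xs ys rs))
          ; runs     = run (≤-trans (s≤s z≤n) (≤-reflexive (sym (↭-length M.perm))))
                           (fits-merge xs ys 0<w fx fy M.perm N.perm) M.sorted N.runs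
          ; regs     = cong₂ _,_ (trans (cong proj₁ N.regs) (cong proj₁ M.regs))
                                 (trans (cong proj₂ N.regs) (cong (proj₁ ∘ proj₂) M.regs))
          ; ctx      = N.ctx }
          where module N = Passed N

      bound : 1 + costᵗ passTest + (price runSetup + ((mergeExit + (length xs + length ys) * mergeStep) + price advance))
                + (passExit + length rs * passStep)
              ≤ passExit + length (xs ++ (ys ++ rs)) * passStep
      -- The pair pays its overhead once; the added term pays it again for each element of the pair
      -- but one, which makes the bound uniform per element.
      bound = ≤-trans (m≤m+n _ ((length xs′ + length ys) * passOverhead)) (≤-reflexive (trans
        (pass-cost (length xs′) (length ys) (length rs) mergeStep passExit
                   (1 + costᵗ passTest) (price runSetup) mergeExit (price advance))
        (cong (λ l → passExit + l * passStep)
              (sym (trans (length-++ xs) (cong (length xs +_) (length-++ ys)))))))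

    pass-correct : ∀ {w xs s} → 0 < w → Runs w xs → PassReady w xs s → PassExec w xs s
    pass-correct {s = s} 0<w [] R =
      within-≤ (≤-reflexive (sym (+-identityʳ passExit))) (while-false {s = s} {b = passTest}
        (cong not (≤ᵇ-true (≤-reflexive (trans in-end (+-identityʳ _)))))
        (record { zs = [] ; appended = appended-[] ; perm = ↭-refl ; runs = [] ; regs = refl ; ctx = ctx }))
      where open PassReady R
    pass-correct 0<w (run {xs} 0<xs fx sx []) R =
      -- A last run without a partner is merged with the empty run, that is, copied.
      pass-pair xs [] [] 0<w 0<xs fx (inj₂ (z≤n , refl)) sx [] R (pass-correct 0<w [])
    pass-correct 0<w (run {xs} 0<xs fx sx (run {ys} {rs} _ fy sy rest)) R =
      pass-pair xs ys rs 0<w 0<xs fx fy sx sy R (pass-correct 0<w rest)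

    record PassesReady (w : ℕ) (xs : List ℕ) (s : Store F) : Set c where
      field
        in-holds : Holds (arr s 0) (reg s 1) xs
        in-end   : reg s 2 ≡ reg s 1 + length xs
        size     : reg s 3 ≡ length xs
        width    : reg s 4 ≡ w
        ctx      : contextOf s ≡ φ

    record Sorted (xs : List ℕ) (s s′ : Store F) : Set (c ⊔ r) where
      field
        zs         : List ℕ
        perm       : zs ↭ xs
        sorted     : AllPairs _⊑_ zs
        out-holds  : Holds (arr s′ 0) (reg s′ 1) zs
        out-end    : reg s′ 2 ≡ reg s′ 1 + length zs
        unchanged  : ∀ i → i < reg s 2 → arr s′ 0 i ≡ arr s 0 i
        ctx        : contextOf s′ ≡ φ

    private
      passes-cost : ∀ l P d E A B X C → let O = A + (B + (X + C)) in
        A + (B + ((X + l * P) + C)) + (E + d * (O + l * P)) ≡ E + suc d * (O + l * P)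
      passes-cost = solve-∀

    PassesExec : ℕ → List ℕ → Store F → Set (c ⊔ r)
    PassesExec d xs s = Exec passes s (passesExit + d * (passesOverhead + length xs * passStep)) (Sorted xs s)

    passes-stop : ∀ d {w xs s} → length xs ≤ w → Runs w xs → PassesReady w xs s → PassesExec d xs s
    passes-stop d {w} {xs} {s} le rs R =
      within-≤ (m≤m+n passesExit _) (while-false {s = s} {b = sortTest}
        (cong not (≤ᵇ-true (≤-trans (≤-reflexive size) (≤-trans le (≤-reflexive (sym width))))))
        (record { zs = xs ; perm = ↭-refl ; sorted = runs-sorted le rs ; out-holds = in-holds
                ; out-end = in-end ; unchanged = λ _ _ → refl ; ctx = ctx }))
      where open PassesReady R

    passes-step : ∀ d {w xs s} → 0 < w → w < length xs → Runs w xs → PassesReady w xs s →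
                  (∀ {zs s′} → length zs ≡ length xs → Runs (w + w) zs → PassesReady (w + w) zs s′ → PassesExec d zs s′) →
                  PassesExec (suc d) xs s
    passes-step d {w} {xs} {s} 0<w w< rs R rest =
      within-≤ (≤-reflexive (passes-cost (length xs) passStep d passesExit
                  (1 + costᵗ sortTest) (price passSetup) passExit (price double)))
        (while-true {s = s} {b = sortTest}
          (cong not (≤ᵇ-false (≤-trans (≤-reflexive (cong suc width)) (≤-trans w< (≤-reflexive (sym size))))))
          (line-then passSetup (pass-correct 0<w rs ready then λ P → line double (continue P))))
      where
      open PassesReady R
      s₁ = effect passSetup s

      ready : PassReady w xs s₁
      ready = record { in-holds = in-holds ; in-end = in-end ; in-below = ≤-refl ; width = width ; ctx = ctx }

      continue : ∀ {s₂} → Passed w xs s₁ s₂ →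
        Exec passes (effect double s₂) (passesExit + d * (passesOverhead + length xs * passStep)) (Sorted xs s)
      continue {s₂} P = map-post finish (subst (λ l → Exec passes s₃ (passesExit + d * (passesOverhead + l * passStep)) (Sorted P.zs s₃))
                                           eq (rest eq P.runs ready′))
        where
        module P = Passed P
        s₃ = effect double s₂
        eq = ↭-length P.perm
        base : reg s₂ 1 ≡ reg s 2
        base = cong proj₁ P.regs
        ready′ : PassesReady (w + w) P.zs s₃
        ready′ = record
          { in-holds = subst (λ i → Holds (arr s₂ 0) i P.zs) (sym base) (holds P.appended)
          ; in-end   = trans (end P.appended) (cong (_+ length P.zs) (sym base))
          ; size     = trans (cong Context.reg3 (trans P.ctx (sym ctx))) (trans size (sym eq))
          ; width    = cong₂ _+_ width₂ width₂
          ; ctx      = P.ctx }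
          where width₂ = trans (cong proj₂ P.regs) width
        finish : ∀ {s₄} → Sorted P.zs s₃ s₄ → Sorted xs s s₄
        finish S = record
          { zs = S.zs ; perm = ↭-trans S.perm P.perm ; sorted = S.sorted ; out-holds = S.out-holds
          ; out-end = S.out-end ; ctx = S.ctx
          ; unchanged = λ i i< → trans (S.unchanged i (≤-trans i< (appended-≤ P.appended))) (below P.appended i i<) }
          where module S = Sorted S

    -- `d` counts the passes still allowed. A pass doubles `w` and lowers `d` by one, so `w * 2 ^ d`
    -- does not change; at `d = 0` it says that a single run is left.
    passes-correct : ∀ d {w xs s} → 0 < w → length xs ≤ w * 2 ^ d → Runs w xs → PassesReady w xs s →
                     PassesExec d xs s
    passes-correct d {w} {xs} 0<w le rs R with length xs ≤? w
    ... | yes xs≤w = passes-stop d xs≤w rs R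
    passes-correct zero {w} 0<w le rs R | no xs≰w = contradiction (≤-trans le (≤-reflexive (*-identityʳ w))) xs≰w
    passes-correct (suc d) {w} {xs} 0<w le rs R | no xs≰w =
      passes-step d 0<w (≰⇒> xs≰w) rs R λ {zs} eq rs′ R′ →
        passes-correct d (≤-trans 0<w (m≤m+n w w)) (≤-trans (≤-reflexive eq) (≤-trans le (≤-reflexive (double-pow w (2 ^ d))))) rs′ R′
      where
      double-pow : ∀ w p → w * (p + (p + 0)) ≡ (w + w) * p
      double-pow = solve-∀

    record Filled (xs : List ℕ) (s s′ : Store F) : Set c where
      field
        appended : Appends s s′ xs
        base     : reg s′ 1 ≡ reg s 1
        ctx      : contextOf s′ ≡ φ

    -- `f` is arbitrary and described pointwise because `applyUpTo` recurses into `f ∘ suc`. The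
    -- output loops are treated in the same way.
    fill-correct : ∀ r {f s} → contextOf s ≡ φ → (∀ x → f x ≡ reg s 6 + x) → reg s 3 ≡ reg s 6 + r →
                   Exec fill s (fillExit + r * fillStep) (Filled (applyUpTo f r) s)
    fill-correct zero {s = s} ctx _ e =
      within-≤ (≤-reflexive (sym (+-identityʳ fillExit))) (while-false {s = s} {b = fillTest}
        (cong not (≤ᵇ-true (≤-reflexive (trans e (+-identityʳ _)))))
        (record { appended = appended-[] ; base = refl ; ctx = ctx }))
    fill-correct (suc r) {f} {s} ctx fx e =
      within-≤ (≤-reflexive (loop-cost fillStep r fillExit)) (while-true {s = s} {b = fillTest}
        (cong not (≤ᵇ-false (≤-trans (s≤s (m≤m+n _ r)) (≤-reflexive (sym e′)))))
        (line fillBody (map-post extend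
          (fill-correct r ctx (λ x → trans (fx (suc x)) (+-suc (reg s 6) x)) e′))))
      where
      e′ = trans e (+-suc (reg s 6) r)
      extend : ∀ {s′} → Filled (applyUpTo (f ∘ suc) r) (effect fillBody s) s′ → Filled (applyUpTo f (suc r)) s s′
      extend G = record
        { appended = appended-++ (appended-entry (sym (trans (fx 0) (+-identityʳ _)))) G.appended
        ; base = G.base ; ctx = G.ctx }
        where module G = Filled G

    sort-correct : ∀ {n s} → contextOf s ≡ φ → reg s 3 ≡ n → Exec sort s (sortCost n) (Sorted (upTo n) s)
    sort-correct {n} {s} ctx refl =
      line-then fillSetup (fill-correct n {id} ctx (λ _ → refl) refl then λ G → line-then (4 ≔ lit 1) (continue G))
      where
      length-n = length-applyUpTo id n
      continue : ∀ {s₂} → Filled (upTo n) (effect fillSetup s) s₂ →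
        Exec passes (effect (4 ≔ lit 1) s₂) (passesExit + ⌈log₂ n ⌉ * (passesOverhead + n * passStep)) (Sorted (upTo n) s)
      continue {s₂} G = map-post finish (subst (λ l → Exec passes s₃ (passesExit + ⌈log₂ n ⌉ * (passesOverhead + l * passStep)) (Sorted (upTo n) s₃))
          length-n
          (passes-correct ⌈log₂ n ⌉ (s≤s z≤n)
            (≤-trans (≤-reflexive length-n) (≤-trans (n≤2^⌈log₂n⌉ n) (≤-reflexive (sym (*-identityˡ _)))))
            (runs-singletons (upTo n)) ready))
        where
        module G = Filled G
        s₃ = effect (4 ≔ lit 1) s₂
        ready : PassesReady 1 (upTo n) s₃
        ready = record
          { in-holds = subst (λ i → Holds (arr s₂ 0) i (upTo n)) (sym G.base) (holds G.appended)
          ; in-end   = trans (end G.appended) (cong (_+ length (upTo n)) (sym G.base))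
          ; size     = trans (cong Context.reg3 (trans G.ctx (sym ctx))) (sym length-n)
          ; width    = refl
          ; ctx      = G.ctx }
        finish : ∀ {s₄} → Sorted (upTo n) s₃ s₄ → Sorted (upTo n) s s₄
        finish S = record
          { zs = S.zs ; perm = S.perm ; sorted = S.sorted ; out-holds = S.out-holds
          ; out-end = S.out-end ; ctx = S.ctx
          ; unchanged = λ i i< → trans (S.unchanged i (≤-trans i< (appended-≤ G.appended))) (below G.appended i i<) }
          where module S = Sorted S

-- Independence numbers, path decompositions and sweeps

module _ {n p} {P : Fin n → Set p} (P? : ∀ v → Dec (P v)) where

  ∈-tabulate⁺ : ∀ {v} → P v → v ∈ Vec.tabulate (does ∘ P?)
  ∈-tabulate⁺ {v} pv = lookup⇒[]= v _ (trans (lookup∘tabulate _ v) (dec-true (P? v) pv))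

  ∈-tabulate⁻ : ∀ {v} → v ∈ Vec.tabulate (does ∘ P?) → P v
  ∈-tabulate⁻ {v} v∈ = decidable-stable (P? v) λ ¬pv →
    contradiction (trans (sym (dec-false (P? v) ¬pv)) (trans (sym (lookup∘tabulate _ v)) ([]=⇒lookup v∈))) λ ()

∈-subsets : ∀ {n} (I : Subset n) → I ∈ₗ subsets n
∈-subsets Vec.[]               = here refl
∈-subsets (inside  Vec.∷ I)     = ∈-++⁺ˡ (∈-map⁺ _ (∈-subsets I))
∈-subsets {suc n} (outside Vec.∷ I) = ∈-++⁺ʳ (map (inside Vec.∷_) (subsets n)) (∈-map⁺ _ (∈-subsets I))

atMostOne⇒∣p∣≤1 : ∀ {n} (I : Subset n) → (∀ u v → u ∈ I → v ∈ I → u ≡ v) → ∣ I ∣ ≤ 1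
atMostOne⇒∣p∣≤1 {n} I eq with nonempty? I
... | yes (x , x∈I) = ≤-trans (p⊆q⇒∣p∣≤∣q∣ λ {v} v∈I → subst (_∈ ⁅ x ⁆) (eq x v x∈I v∈I) (x∈⁅x⁆ x))
                              (≤-reflexive (∣⁅x⁆∣≡1 x))
... | no empty = ≤-trans (≤-reflexive (trans (cong ∣_∣ (Empty-unique empty)) (∣⊥∣≡0 n))) z≤n

module _ {n ℓ} (G : Graph n ℓ) where
  open Graph G using (Adj; irrefl)

  private
    InducedIndependent? : (S : Subset n) → ∀ I → Dec (I ⊆ S × Independent G I)
    InducedIndependent? S I = (I ⊆? S) ×-dec independent? G I

  ∣I∣≤α : ∀ {S I} → I ⊆ S → Independent G I → ∣ I ∣ ≤ α G S
  ∣I∣≤α {S} {I} I⊆S ind = All.lookup (xs≤max 0 _)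
    (∈-map⁺ ∣_∣ (∈-filter⁺ (InducedIndependent? S) (∈-subsets I) ((λ {x} → I⊆S {x}) , ind)))

  α≤ : ∀ S {k} → (∀ I → I ⊆ S → Independent G I → ∣ I ∣ ≤ k) → α G S ≤ k
  α≤ S {k} bound = max≤v⁺ z≤n (All.tabulate below)
    where
    below : ∀ {l} → l ∈ₗ map ∣_∣ (filter (InducedIndependent? S) (subsets n)) → l ≤ k
    below l∈ with I , I∈ , refl ← ∈-map⁻ ∣_∣ l∈
             with _ , I⊆S , ind ← ∈-filter⁻ (InducedIndependent? S) {xs = subsets n} I∈ = bound I I⊆S ind

  clique⇒α≤1 : ∀ {S} → (∀ u v → u ∈ S → v ∈ S → u ≢ v → Adj u v) → α G S ≤ 1
  clique⇒α≤1 {S} adj = α≤ S λ I I⊆S ind → atMostOne⇒∣p∣≤1 I λ u v u∈I v∈I →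
    decidable-stable (u Finₚ.≟ v) λ u≢v → ind u v u∈I v∈I (adj u v (I⊆S u∈I) (I⊆S v∈I) u≢v)

  inhabited⇒1≤α : ∀ {S v} → v ∈ S → 1 ≤ α G S
  inhabited⇒1≤α {S} {v} v∈S = ≤-trans (≤-reflexive (sym (∣⁅x⁆∣≡1 v)))
    (∣I∣≤α (λ x∈ → subst (_∈ S) (sym (x∈⁅y⁆⇒x≡y v x∈)) v∈S)
           λ x y x∈ y∈ → subst (λ z → ¬ Adj x z) (trans (x∈⁅y⁆⇒x≡y v x∈) (sym (x∈⁅y⁆⇒x≡y v y∈))) (irrefl x))

-- The value is found exactly: 0 without vertices, and 1 otherwise, because in every decomposition
-- and layering some bag meets the layer of a given vertex in that vertex, so that no smaller
-- maximum is possible.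
layeredTreeIndependence≤1 : ∀ {n ℓ k} (G : Graph n ℓ) (D : TreeDecomposition G (suc k)) (L : Layering G) →
  (∀ x i → α G (TreeDecomposition.bag D x ∩ Layering.part L i) ≤ 1) →
  ∃ λ l → IsLayeredTreeIndependenceNumber G l × l ≤ 1
layeredTreeIndependence≤1 {zero} G D L _ =
  0 , ((_ , D , L , (zero , 0 , α≡0 (bag D zero ∩ part L 0)) ,
        λ m (x , i , eq) → ≤-reflexive (trans (sym eq) (α≡0 (bag D x ∩ part L i)))) , λ _ _ → z≤n) , z≤n
  where
  open TreeDecomposition
  open Layering
  α≡0 : ∀ S → α G S ≡ 0
  α≡0 S = n≤0⇒n≡0 (α≤ G S λ { Vec.[] _ _ → z≤n })
layeredTreeIndependence≤1 {suc n} G D L α≤1 =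
  1 , ((_ , D , L , maximum) , λ m (_ , D′ , L′ , _ , max) → ≤-trans (1≤α D′ L′) (max _ (node D′ , layer L′ zero , refl)))
    , ≤-refl
  where
  open TreeDecomposition
  open Layering
  node : ∀ {k} → TreeDecomposition G k → Fin k
  node D′ = proj₁ (vertexCovered D′ zero)
  1≤α : ∀ {k} (D′ : TreeDecomposition G k) (L′ : Layering G) → 1 ≤ α G (bag D′ (node D′) ∩ part L′ (layer L′ zero))
  1≤α D′ L′ = inhabited⇒1≤α G
    (x∈p∩q⁺ (proj₂ (vertexCovered D′ zero) , ∈-tabulate⁺ (λ v → layer L′ v ≟ layer L′ zero) refl))
  maximum : IsLayeredIndependence G D L 1
  maximum = (node D , layer L zero , ≤-antisym (α≤1 _ _) (1≤α D L)) , λ m (x , i , eq) → ≤-trans (≤-reflexive (sym eq)) (α≤1 x i)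

-- Paths are trees

module PathGraph (m : ℕ) where

  Next : Fin (suc m) → Fin (suc m) → Set
  Next s t = suc (toℕ s) ≡ toℕ t

  path : Graph (suc m) 0ℓ
  path = record
    { Adj    = λ s t → Next s t ⊎ Next t s
    ; adj?   = λ s t → (suc (toℕ s) ≟ toℕ t) ⊎-dec (suc (toℕ t) ≟ toℕ s)
    ; sym    = swap
    ; irrefl = λ v → [ 1+n≢n , 1+n≢n ]′
    }

  open Graph path using (Adj)

  module _ {p} (P : Fin (suc m) → Set p) where

    Step : Fin (suc m) → Fin (suc m) → Set p
    Step x y = Adj x y × P x × P y

    walk : ∀ d s t → toℕ t ≡ d + toℕ s →
           (∀ x → toℕ s ≤ toℕ x → toℕ x ≤ toℕ t → P x) → Star Step s t
    walk zero    s t eq _ with refl ← Finₚ.toℕ-injective eq = ε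
    walk (suc d) s t eq between =
      (inj₁ (sym s′≡) , between s ≤-refl s≤t , between s′ (≤-trans (n≤1+n _) (≤-reflexive (sym s′≡))) (≤-trans (≤-reflexive s′≡) s<t))
      ◅ walk d s′ t eq′ λ x s′≤x → between x (≤-trans (n≤1+n _) (≤-trans (≤-reflexive (sym s′≡)) s′≤x))
      where
      s<t : suc (toℕ s) ≤ toℕ t
      s<t = ≤-trans (s≤s (m≤n+m (toℕ s) d)) (≤-reflexive (sym eq))
      s≤t = ≤-trans (n≤1+n _) s<t
      s′< = ≤-trans (s≤s s<t) (Finₚ.toℕ<n t)
      s′ = fromℕ< s′<
      s′≡ : toℕ s′ ≡ suc (toℕ s)
      s′≡ = Finₚ.toℕ-fromℕ< s′<
      eq′ : toℕ t ≡ d + toℕ s′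
      eq′ = trans eq (trans (sym (+-suc d (toℕ s))) (cong (d +_) (sym s′≡)))

    -- Serves twice: membership in the bags gives the subtree condition, and a predicate that always
    -- holds gives connectedness of the path.
    convex-walk : (∀ {x y z} → toℕ x ≤ toℕ y → toℕ y ≤ toℕ z → P x → P z → P y) →
                  ∀ s t → P s → P t → Star Step s t
    convex-walk convex s t ps pt with ≤-total (toℕ s) (toℕ t)
    ... | inj₁ s≤t = walk (toℕ t ∸ toℕ s) s t (sym (m∸n+n≡m s≤t)) λ x s≤x x≤t → convex s≤x x≤t ps pt
    ... | inj₂ t≤s = reverse (λ (a , px , py) → swap a , py , px)
                       (walk (toℕ s ∸ toℕ t) t s (sym (m∸n+n≡m t≤s)) λ x t≤x x≤s → convex t≤x x≤s pt ps)

  -- An injective walk on the path cannot turn, so it ends as far from its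
  -- start as it is long.
  ascends : ∀ k (c : Fin (2 + k) → ℕ) → Injective _≡_ _≡_ c →
            (∀ (i : Fin (suc k)) → suc (c (inject₁ i)) ≡ c (suc i) ⊎ suc (c (suc i)) ≡ c (inject₁ i)) →
            suc (c zero) ≡ c (suc zero) → c (fromℕ (suc k)) ≡ suc k + c zero
  ascends zero    c inj steps up = sym up
  ascends (suc k) c inj steps up with steps (suc zero)
  ... | inj₁ up′ = trans (ascends k (c ∘ suc) (Finₚ.suc-injective ∘ inj) (steps ∘ suc) up′)
                         (trans (cong (suc k +_) (sym up)) (+-suc (suc k) (c zero)))
  ... | inj₂ down = contradiction (inj (suc-injective (trans up (sym down)))) λ ()

  descends : ∀ k (c : Fin (2 + k) → ℕ) → Injective _≡_ _≡_ c →
             (∀ (i : Fin (suc k)) → suc (c (inject₁ i)) ≡ c (suc i) ⊎ suc (c (suc i)) ≡ c (inject₁ i)) →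
             suc (c (suc zero)) ≡ c zero → c zero ≡ suc k + c (fromℕ (suc k))
  descends zero    c inj steps down = sym down
  descends (suc k) c inj steps down with steps (suc zero)
  ... | inj₂ down′ = trans (sym down) (cong suc (descends k (c ∘ suc) (Finₚ.suc-injective ∘ inj) (steps ∘ suc) down′))
  ... | inj₁ up = contradiction (inj (trans (sym down) up)) λ ()

  path-isTree : IsTree path
  path-isTree = record
    { nonempty  = _
    ; connected = λ u v → map⋆ proj₁ (convex-walk (λ _ → u ≡ u) (λ _ _ _ _ → refl) u v refl refl)
    ; acyclic   = acyclic
    }
    where
    far : ∀ k {a b} → a ≡ 2 + k + b → ¬ (suc a ≡ b ⊎ suc b ≡ a)
    far k {a} {b} eq (inj₁ e) = <⇒≢ (s≤s (≤-trans (m≤n+m b (2 + k)) (≤-reflexive (sym eq)))) (sym e)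
    far k {a} {b} eq (inj₂ e) = <⇒≢ (s≤s (s≤s (m≤n+m b k))) (trans e eq)
    acyclic : Acyclic path
    -- The first step fixes the direction of the whole walk, so its ends lie `2 + k` apart and are
    -- not adjacent.
    acyclic k c inj steps close with steps zero
    ... | inj₁ up   = far k (ascends (suc k) (toℕ ∘ c) (inj ∘ Finₚ.toℕ-injective) steps up) close
    ... | inj₂ down = far k (descends (suc k) (toℕ ∘ c) (inj ∘ Finₚ.toℕ-injective) steps down) (swap close)

-- From a sweep to a tree decomposition and a layering

module Coordinates {c ℓ₁ ℓ₂} (F : OrderedField c ℓ₁ ℓ₂) {n} (R : UnitWidthFamily F n) where
  open OrderedField F public using (Carrier; _≈_; module Order) renaming (_≤_ to _≤ᶠ_)
  open UnitWidthFamily R public using (rect; sameWidth)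

  left right bottom top : Fin n → Carrier
  left   v = Rectangle.left (rect v)
  right  v = Rectangle.right (rect v)
  bottom v = Rectangle.bottom (rect v)
  top    v = Rectangle.top (rect v)

  left≤right : ∀ v → left v ≤ᶠ right v
  left≤right v = proj₁ (Rectangle.left<right (rect v))

  bottom≤top : ∀ v → bottom v ≤ᶠ top v
  bottom≤top v = proj₁ (Rectangle.bottom<top (rect v))

-- inj₁ v stands for the lower side of rectangle v, where v is introduced, and
-- inj₂ v for its upper side, where v is forgotten. Node t of the path comes
-- after the first t events.
record Sweep {c ℓ₁ ℓ₂} (F : OrderedField c ℓ₁ ℓ₂) {n} (R : UnitWidthFamily F n) (m : ℕ) : Set (c ⊔ ℓ₂) where
  open Coordinates F R
  field
    event : Fin m → Fin n ⊎ Fin n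
    occurs : ∀ e → ∃ λ t → event t ≡ e
    intro-forget : ∀ {s t u v} → toℕ s < toℕ t → event s ≡ inj₁ v → event t ≡ inj₂ u → bottom v ≤ᶠ top u
    forget-intro : ∀ {s t u v} → toℕ s < toℕ t → event s ≡ inj₂ u → event t ≡ inj₁ v → ¬ (bottom v ≤ᶠ top u)
    lay  : Fin n → ℕ
    near : ∀ u v → left u ≤ᶠ right v → left v ≤ᶠ right u → ∣ lay u - lay v ∣ ≤ 1
    same : ∀ u v → lay u ≡ lay v → left u ≤ᶠ right v

module Decomposition {c ℓ₁ ℓ₂} (F : OrderedField c ℓ₁ ℓ₂) {n} {R : UnitWidthFamily F n} {m} (sweep : Sweep F R m) where
  open Coordinates F R
  open Sweep sweep
  open PathGraph m
  open Graph (intersectionGraph F R) using (Adj)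

  Seen : Fin (suc m) → Fin n ⊎ Fin n → Set
  Seen t e = ∃ λ i → toℕ i < toℕ t × event i ≡ e

  seen? : ∀ t e → Dec (Seen t e)
  seen? t e = Finₚ.any? λ i → (toℕ i <? toℕ t) ×-dec Sumₚ.≡-dec Finₚ._≟_ Finₚ._≟_ (event i) e

  seen-mono : ∀ {s t e} → toℕ s ≤ toℕ t → Seen s e → Seen t e
  seen-mono s≤t (i , i<s , eq) = i , ≤-trans i<s s≤t , eq

  seen-suc⁻ : ∀ {t e} → Seen (suc t) e → Seen (inject₁ t) e ⊎ event t ≡ e
  seen-suc⁻ {t} (i , s≤s i≤t , eq) with m≤n⇒m<n∨m≡n i≤t
  ... | inj₁ i<t = inj₁ (i , ≤-trans i<t (≤-reflexive (sym (Finₚ.toℕ-inject₁ t))) , eq)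
  ... | inj₂ i≡t = inj₂ (trans (cong event (sym (Finₚ.toℕ-injective i≡t))) eq)

  inject₁≤suc : ∀ (t : Fin m) → toℕ (inject₁ t) ≤ suc (toℕ t)
  inject₁≤suc t = ≤-trans (≤-reflexive (Finₚ.toℕ-inject₁ t)) (n≤1+n _)

  InBag : Fin (suc m) → Fin n → Set
  InBag t v = Seen t (inj₁ v) × ¬ Seen t (inj₂ v)

  inBag? : ∀ t v → Dec (InBag t v)
  inBag? t v = seen? t (inj₁ v) ×-dec ¬? (seen? t (inj₂ v))

  bags : Fin (suc m) → Subset n
  bags t = Vec.tabulate (does ∘ inBag? t)

  ∈-bags⁺ : ∀ {t v} → InBag t v → v ∈ bags t
  ∈-bags⁺ {t} = ∈-tabulate⁺ (inBag? t)

  ∈-bags⁻ : ∀ {t v} → v ∈ bags t → InBag t v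
  ∈-bags⁻ {t} = ∈-tabulate⁻ (inBag? t)

  -- By `forget-intro`, upper sides met before the lower side of `v` lie strictly below it; `u`
  -- reaches up to `bottom v`, so its upper side is not among them.
  unforgotten : ∀ {t u v} → event t ≡ inj₁ v → bottom v ≤ᶠ top u → ¬ Seen (suc t) (inj₂ u)
  unforgotten {t} eq v≤u (i , s≤s i≤t , eq′) with m≤n⇒m<n∨m≡n i≤t
  ... | inj₁ i<t = forget-intro i<t eq′ eq v≤u
  ... | inj₂ i≡t with refl ← Finₚ.toℕ-injective i≡t = contradiction (trans (sym eq) eq′) λ ()

  introduced : ∀ {t v} → event t ≡ inj₁ v → InBag (suc t) v
  introduced {t} {v} eq = (t , ≤-refl , eq) , unforgotten eq (bottom≤top v)

  -- The lower side of `v` was met before node `t`, and the upper side of `u` is met only after it.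
  bag-overlap : ∀ {t u v} → InBag t u → InBag t v → bottom v ≤ᶠ top u
  bag-overlap {t} {u} (_ , ¬forgotten) ((i , i<t , eq) , _) with j , eq′ ← occurs (inj₂ u) =
    intro-forget (≤-trans i<t (≮⇒≥ λ j<t → ¬forgotten (j , j<t , eq′))) eq eq′

  bag-convex : ∀ {v x y z} → toℕ x ≤ toℕ y → toℕ y ≤ toℕ z → InBag x v → InBag z v → InBag y v
  bag-convex x≤y y≤z (seen , _) (_ , ¬forgotten) = seen-mono x≤y seen , ¬forgotten ∘ seen-mono y≤z

  overlaps : ∀ u v → Adj u v →
    (left u ≤ᶠ right v × left v ≤ᶠ right u) × (bottom u ≤ᶠ top v × bottom v ≤ᶠ top u)
  overlaps u v (_ , x , y , ((a , b) , (d , e)) , ((a′ , b′) , (d′ , e′))) =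
    (Order.trans a b′ , Order.trans a′ b) , (Order.trans d e′ , Order.trans d′ e)

  common-point : ∀ {a b a′ b′} → a ≤ᶠ b → a′ ≤ᶠ b′ → a ≤ᶠ b′ → a′ ≤ᶠ b → Overlap.Meet F a b a′ b′
  common-point {a} {b} {a′} {b′} p q r s with Order.total a a′
  ... | inj₁ a≤a′ = a′ , (a≤a′ , s) , (Order.refl , q)
  ... | inj₂ a′≤a = a , (Order.refl , p) , (a′≤a , r)

  -- The node just after the later of the two lower sides works: by `unforgotten`, the other
  -- rectangle is still open there.
  edge-bag : ∀ u v → Adj u v → ∃ λ t → u ∈ bags t × v ∈ bags t
  edge-bag u v adj with occurs (inj₁ u) | occurs (inj₁ v)
  ... | i , eq | j , eq′ with ≤-total (toℕ i) (toℕ j)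
  ... | inj₁ i≤j = suc j , ∈-bags⁺ ((i , s≤s i≤j , eq) , unforgotten eq′ (proj₂ (proj₂ (overlaps u v adj)))) , ∈-bags⁺ (introduced eq′)
  ... | inj₂ j≤i = suc i , ∈-bags⁺ (introduced eq) , ∈-bags⁺ ((j , s≤s j≤i , eq′) , unforgotten eq (proj₁ (proj₂ (overlaps u v adj))))

  decomposition : TreeDecomposition (intersectionGraph F R) (suc m)
  decomposition = record
    { tree          = path
    ; isTree        = path-isTree
    ; bag           = bags
    ; vertexCovered = λ v → let t , eq = occurs (inj₁ v) in suc t , ∈-bags⁺ (introduced eq)
    ; edgeCovered   = edge-bag
    ; subtree       = λ v s t s∈ t∈ →
        let nodes⁻ = ∈-tabulate⁻ λ t → v ∈? bags t
            nodes⁺ = ∈-tabulate⁺ λ t → v ∈? bags t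
        in map⋆ (λ (a , px , py) → a , nodes⁺ px , nodes⁺ py)
             (convex-walk (λ t → v ∈ bags t)
               (λ x≤y y≤z px pz → ∈-bags⁺ (bag-convex x≤y y≤z (∈-bags⁻ px) (∈-bags⁻ pz)))
               s t (nodes⁻ s∈) (nodes⁻ t∈))
    }

  layering : Layering (intersectionGraph F R)
  layering = record
    { layer        = lay
    ; edgesAreNear = λ u v adj → let (p , q) , _ = overlaps u v adj in near u v p q
    }

  α≤1 : ∀ x i → α (intersectionGraph F R) (bags x ∩ Layering.part layering i) ≤ 1
  α≤1 x i = clique⇒α≤1 (intersectionGraph F R) λ u v u∈ v∈ u≢v →
    let u∈bag , u∈part = x∈p∩q⁻ (bags x) (Layering.part layering i) u∈
        v∈bag , v∈part = x∈p∩q⁻ (bags x) (Layering.part layering i) v∈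
        part⁻ = ∈-tabulate⁻ λ v → lay v ≟ i
        lay≡ = trans (part⁻ u∈part) (sym (part⁻ v∈part))
        xu , p , q = common-point (left≤right u) (left≤right v) (same u v lay≡) (same v u (sym lay≡))
        yu , r , s = common-point (bottom≤top u) (bottom≤top v)
                       (bag-overlap (∈-bags⁻ v∈bag) (∈-bags⁻ u∈bag)) (bag-overlap (∈-bags⁻ u∈bag) (∈-bags⁻ v∈bag))
    in u≢v , xu , yu , (p , r) , (q , s)

  forgetOf introduceOf : Fin n ⊎ Fin n → List (Fin n)
  forgetOf    = [ const [] , [_] ]′
  introduceOf = [ [_] , const [] ]′

  description : Description n m
  description = record
    { layerOf   = lay
    ; parent    = inject₁
    ; parent≤   = λ t → ≤-reflexive (Finₚ.toℕ-inject₁ t)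
    ; forget    = forgetOf ∘ event
    ; introduce = λ { zero → [] ; (suc t) → introduceOf (event t) }
    }

  open Description description using (Parent)

  next⇒parent : ∀ {s t} → Next s t → Parent s t
  next⇒parent {s} {suc i} eq = i , Finₚ.toℕ-injective (trans (suc-injective eq) (sym (Finₚ.toℕ-inject₁ i))) , refl

  parent⇒next : ∀ {s t} → Parent s t → Next s t
  parent⇒next (i , refl , refl) = cong suc (Finₚ.toℕ-inject₁ i)

  child⇒ : ∀ t v → InBag (suc t) v → (InBag (inject₁ t) v × v ∉ₗ forgetOf (event t)) ⊎ v ∈ₗ introduceOf (event t)
  child⇒ t v (seen , ¬forgotten) with seen-suc⁻ seen
  ... | inj₂ eq rewrite eq = inj₂ (here refl)
  ... | inj₁ seen′ = inj₁ ((seen′ , ¬forgotten ∘ seen-mono (inject₁≤suc t)) , not-now (event t) refl)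
    where
    not-now : ∀ e → event t ≡ e → v ∉ₗ forgetOf e
    not-now (inj₂ w) eq (here refl) = ¬forgotten (t , ≤-refl , eq)

  child⇐ : ∀ t v → (InBag (inject₁ t) v × v ∉ₗ forgetOf (event t)) ⊎ v ∈ₗ introduceOf (event t) → InBag (suc t) v
  child⇐ t v (inj₁ ((seen , ¬forgotten) , v∉)) = seen-mono (inject₁≤suc t) seen , [ ¬forgotten , now ]′ ∘ seen-suc⁻
    where
    now : ¬ (event t ≡ inj₂ v)
    now eq = v∉ (subst (λ e → v ∈ₗ forgetOf e) (sym eq) (here refl))
  child⇐ t v (inj₂ v∈) = by-event (event t) refl v∈
    where
    by-event : ∀ e → event t ≡ e → v ∈ₗ introduceOf e → InBag (suc t) v
    by-event (inj₁ w) eq (here refl) = introduced eq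

  describes : Describes description decomposition layering
  describes = record
    { layers   = λ v → refl
    ; edges    = λ s t → mk⇔ (Sum.map next⇒parent next⇒parent) (Sum.map parent⇒next parent⇒next)
    ; rootBag  = λ v → mk⇔ (λ v∈ → contradiction (∈-bags⁻ v∈) λ { ((_ , () , _) , _) }) λ ()
    ; childBag = λ t v → mk⇔
        (Sum.map (λ (b , v∉) → ∈-bags⁺ b , v∉) id ∘ child⇒ t v ∘ ∈-bags⁻)
        (∈-bags⁺ ∘ child⇐ t v ∘ Sum.map (λ (b , v∉) → ∈-bags⁻ b , v∉) id)
    }

-- The order of the sides and the greedy layers

ifᵗ : Test → Test → Test → Test
ifᵗ b t u = orᵗ (andᵗ b t) (andᵗ (notᵗ b) u)

-- Of the eight coordinate arrays, 0, 1, 2 and 5 are used: they hold the left, lower, right and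
-- upper sides.
leftCompare eventCompare : NExp → NExp → Test
leftCompare d e = atʳ 0 d ≤ʳ atʳ 0 e
eventCompare d e = ifᵗ (var 0 ≤ⁿ d)
  (ifᵗ (var 0 ≤ⁿ e) (atʳ 5 (d ⊖ var 0) ≤ʳ atʳ 5 (e ⊖ var 0)) (notᵗ (atʳ 1 e ≤ʳ atʳ 5 (d ⊖ var 0))))
  (ifᵗ (var 0 ≤ⁿ e) (atʳ 1 d ≤ʳ atʳ 5 (e ⊖ var 0)) (atʳ 1 d ≤ʳ atʳ 1 e))

-- Register 1 is the reading position in the sorted list, register 11 the current layer and register
-- 12 its opener; array 1 receives the layers.
sameLayer newLayer : Program
sameLayer = 1 ⟦ at 0 (var 1) ⟧≔ var 11 ⨾ 1 ≔ lit 1 ⊕ var 1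
newLayer  = 12 ≔ at 0 (var 1) ⨾ 11 ≔ lit 1 ⊕ var 11 ⨾ sameLayer

layerTest extendsLayer : Test
layerTest    = notᵗ (var 2 ≤ⁿ var 1)
extendsLayer = atʳ 0 (at 0 (var 1)) ≤ʳ atʳ 2 (var 12)

assignLayers : Program
assignLayers = while layerTest (ifᵖ extendsLayer sameLayer newLayer)

module Orders {c ℓ₁ ℓ₂} (F : OrderedField c ℓ₁ ℓ₂) where
  open OrderedField F using (Carrier; module Order) renaming (_≤_ to _≤ᶠ_)
  open Machine F
  open Context

  ≰⇒≥ᶠ : ∀ {x y} → ¬ (x ≤ᶠ y) → y ≤ᶠ x
  ≰⇒≥ᶠ {x} {y} x≰y = [ (λ x≤y → contradiction x≤y x≰y) , id ]′ (Order.total x y)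

  Side : Set c
  Side = Carrier ⊎ Carrier

  -- Lower sides (inj₁) come before upper sides (inj₂) at the same height.
  _≼_ : Side → Side → Set ℓ₂
  inj₁ x ≼ inj₁ y = x ≤ᶠ y
  inj₁ x ≼ inj₂ y = x ≤ᶠ y
  inj₂ x ≼ inj₁ y = ¬ (y ≤ᶠ x)
  inj₂ x ≼ inj₂ y = x ≤ᶠ y

  _≼?_ : ∀ a b → Dec (a ≼ b)
  inj₁ x ≼? inj₁ y = x Order.≤? y
  inj₁ x ≼? inj₂ y = x Order.≤? y
  inj₂ x ≼? inj₁ y = ¬? (y Order.≤? x)
  inj₂ x ≼? inj₂ y = x Order.≤? y

  ≼-total : ∀ a b → a ≼ b ⊎ b ≼ a
  ≼-total (inj₁ x) (inj₁ y) = Order.total x y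
  ≼-total (inj₂ x) (inj₂ y) = Order.total x y
  ≼-total (inj₁ x) (inj₂ y) with x Order.≤? y
  ... | yes x≤y = inj₁ x≤y
  ... | no  x≰y = inj₂ x≰y
  ≼-total (inj₂ x) (inj₁ y) with y Order.≤? x
  ... | yes y≤x = inj₂ y≤x
  ... | no  y≰x = inj₁ y≰x

  ≼-trans : ∀ a b d → a ≼ b → b ≼ d → a ≼ d
  ≼-trans (inj₁ x) (inj₁ y) (inj₁ z) p q = Order.trans p q
  ≼-trans (inj₁ x) (inj₁ y) (inj₂ z) p q = Order.trans p q
  ≼-trans (inj₁ x) (inj₂ y) (inj₁ z) p q = Order.trans p (≰⇒≥ᶠ q)
  ≼-trans (inj₁ x) (inj₂ y) (inj₂ z) p q = Order.trans p q
  ≼-trans (inj₂ x) (inj₁ y) (inj₁ z) p q = p ∘ Order.trans q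
  ≼-trans (inj₂ x) (inj₁ y) (inj₂ z) p q = Order.trans (≰⇒≥ᶠ p) q
  ≼-trans (inj₂ x) (inj₂ y) (inj₁ z) p q = λ z≤x → q (Order.trans z≤x p)
  ≼-trans (inj₂ x) (inj₂ y) (inj₂ z) p q = Order.trans p q

  -- The lower sides are numbered 0, …, n - 1 and the upper sides n, …, 2n - 1.
  side : (ℕ → ℕ → Carrier) → ℕ → ℕ → Side
  side ρ n e = if n ≤ᵇ e then inj₂ (ρ 5 (e ∸ n)) else inj₁ (ρ 1 e)

  eval-ifᵗ : ∀ s b t u → evalᵗ F s (ifᵗ b t u) ≡ (if evalᵗ F s b then evalᵗ F s t else evalᵗ F s u)
  eval-ifᵗ s b t u with evalᵗ F s b
  ... | true  = ∨-identityʳ _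
  ... | false = refl

  eventCompare-≼ : ∀ {φ} s → contextOf s ≡ φ → ∀ d e →
    evalᵗ F s (eventCompare d e) ≡ does (side (reals φ) (reg0 φ) (evalⁿ F s d) ≼? side (reals φ) (reg0 φ) (evalⁿ F s e))
  eventCompare-≼ s refl d e
    rewrite eval-ifᵗ s (var 0 ≤ⁿ d)
              (ifᵗ (var 0 ≤ⁿ e) (atʳ 5 (d ⊖ var 0) ≤ʳ atʳ 5 (e ⊖ var 0)) (notᵗ (atʳ 1 e ≤ʳ atʳ 5 (d ⊖ var 0))))
              (ifᵗ (var 0 ≤ⁿ e) (atʳ 1 d ≤ʳ atʳ 5 (e ⊖ var 0)) (atʳ 1 d ≤ʳ atʳ 1 e))
          | eval-ifᵗ s (var 0 ≤ⁿ e) (atʳ 5 (d ⊖ var 0) ≤ʳ atʳ 5 (e ⊖ var 0)) (notᵗ (atʳ 1 e ≤ʳ atʳ 5 (d ⊖ var 0)))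
          | eval-ifᵗ s (var 0 ≤ⁿ e) (atʳ 1 d ≤ʳ atʳ 5 (e ⊖ var 0)) (atʳ 1 d ≤ʳ atʳ 1 e)
    with reg s 0 ≤ᵇ evalⁿ F s d | reg s 0 ≤ᵇ evalⁿ F s e
  ... | true  | true  = refl
  ... | true  | false = refl
  ... | false | true  = refl
  ... | false | false = refl

-- The equality of the widths enters through `mono`.
module GreedyLayers {c ℓ₁ ℓ₂} (F : OrderedField c ℓ₁ ℓ₂) (n : ℕ) (l r : ℕ → OrderedField.Carrier F)
    (l≤r : ∀ {u} → u < n → OrderedField._≤_ F (l u) (r u))
    (mono : ∀ {u v} → u < n → v < n → OrderedField._≤_ F (l u) (l v) → OrderedField._≤_ F (r u) (r v))
    where
  open OrderedField F using (module Order) renaming (_≤_ to _≤ᶠ_)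

  -- The conditions on the layers a of u and b of v.
  Compatible : (u a v b : ℕ) → Set ℓ₂
  Compatible u a v b = (l u ≤ᶠ r v → l v ≤ᶠ r u → ∣ a - b ∣ ≤ 1) × (a ≡ b → l u ≤ᶠ r v)

  -- All conditions refer to the current opener `b` only. With them, `current` makes a rectangle
  -- that joins the layer overlap its members, and `older` keeps it apart from layers two or more
  -- below; `old` turns into `older` when the next layer is opened.
  record Placed (lay : ℕ → ℕ) (h b u : ℕ) : Set ℓ₂ where
    field
      bounded : u < n
      highest : lay u ≤ h
      current : lay u ≡ h → r b ≤ᶠ r u
      old     : lay u < h → r u ≤ᶠ r b
      older   : suc (lay u) < h → ¬ (l b ≤ᶠ r u)

  -- The rectangles in us have been assigned layers; vs are still to come. The
  -- current layer h was opened by the rectangle b.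
  record Greedy (lay : ℕ → ℕ) (h b : ℕ) (us vs : List ℕ) : Set ℓ₂ where
    field
      opener     : All (λ v → b < n × l b ≤ᶠ l v) vs
      placed     : ∀ {u} → u ∈ₗ us → Placed lay h b u
      compatible : ∀ {u v} → u ∈ₗ us → v ∈ₗ us → Compatible u (lay u) v (lay v)
      before     : ∀ {u v} → u ∈ₗ us → v ∈ₗ vs → l u ≤ᶠ l v × v ≢ u
      sorted     : AllPairs (λ u v → l u ≤ᶠ l v) vs
      unique     : Unique vs
      vs<n       : All (_< n) vs

  near-below : ∀ {a b} → a ≤ b → ¬ (suc a < b) → ∣ a - b ∣ ≤ 1
  near-below {a} {b} a≤b ¬lt = ≤-trans (≤-reflexive (m≤n⇒∣m-n∣≡n∸m a≤b))
    (≤-trans (∸-monoˡ-≤ a (≮⇒≥ ¬lt)) (≤-reflexive (m+n∸n≡m 1 a)))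

  module _ {lay h b us v vs} (G : Greedy lay h b us (v ∷ vs)) where
    open Greedy G
    open Placed

    private
      v<n = All.head vs<n

      b≤v : l b ≤ᶠ l v
      b≤v = proj₂ (All.head opener)

      module _ (h′ : ℕ) where
        lay′ = lay [ v ↦ h′ ]

        at-v : lay′ v ≡ h′
        at-v = ↦-same lay v h′

        unchanged : ∀ {u} → u ∈ₗ us → lay′ u ≡ lay u
        unchanged u∈ = ↦-other lay h′ λ u≡v → proj₂ (before u∈ (here refl)) (sym u≡v)

      extend : ∀ {h′ b′} → b′ < n → l b′ ≤ᶠ l v → All (λ w → b′ < n × l b′ ≤ᶠ l w) vs →
               (∀ {u} → Placed lay h b u → u ∈ₗ us → (l v ≤ᶠ r u → ∣ lay u - h′ ∣ ≤ 1) × (lay u ≡ h′ → l v ≤ᶠ r u)) →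
               (∀ {u} → u ∈ₗ us → Placed lay h′ b′ u) →
               Greedy (lay′ h′) h′ b′ (v ∷ us) vs
      extend {h′} {b′} b′<n b′≤v b′≤ new old-placed = record
        { opener     = b′≤
        ; placed     = λ { (here refl) → placed-v ; (there u∈) → placed-u u∈ }
        ; compatible = λ { (here refl) (here refl) → (λ _ _ → ≤-trans (≤-reflexive (∣n-n∣≡0 (lay′ h′ v))) z≤n) , λ _ → l≤r v<n
                         ; (here refl) (there u∈) → v-u u∈
                         ; (there u∈) (here refl) → u-v u∈
                         ; {u} {w} (there u∈) (there w∈) → subst₂ (λ a b → Compatible u a w b) (sym (unchanged h′ u∈)) (sym (unchanged h′ w∈)) (compatible u∈ w∈) }
        ; before     = λ { (here refl) w∈ → All.lookup (AllPairs.head sorted) w∈ , λ w≡v → All.lookup (AllPairs.head unique) w∈ (sym w≡v)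
                         ; (there u∈) w∈ → before u∈ (there w∈) }
        ; sorted     = AllPairs.tail sorted
        ; unique     = AllPairs.tail unique
        ; vs<n       = All.tail vs<n
        }
        where
        placed-v : Placed (lay′ h′) h′ b′ v
        placed-v = record
          { bounded = v<n
          ; highest = ≤-reflexive (at-v h′)
          ; current = λ _ → mono b′<n v<n b′≤v
          ; old     = λ lt → contradiction (at-v h′) (<⇒≢ lt)
          ; older   = λ lt → contradiction (at-v h′) (<⇒≢ (≤-trans (n≤1+n _) lt))
          }
        placed-u : ∀ {u} → u ∈ₗ us → Placed (lay′ h′) h′ b′ u
        placed-u {u} u∈ = record
          { bounded = bounded P
          ; highest = subst (_≤ h′) (sym eq) (highest P)
          ; current = λ e → current P (trans (sym eq) e)
          ; old     = λ e → old P (subst (_< h′) eq e)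
          ; older   = λ e → older P (subst (λ a → suc a < h′) eq e)
          }
          where
          P = old-placed u∈
          eq = unchanged h′ u∈
        v-u : ∀ {u} → u ∈ₗ us → Compatible v (lay′ h′ v) u (lay′ h′ u)
        v-u {u} u∈ = subst₂ (λ a b → Compatible v a u b) (sym (at-v h′)) (sym (unchanged h′ u∈))
          ( (λ v≤u _ → subst (_≤ 1) (∣-∣-comm (lay u) h′) (proj₁ (new (placed u∈) u∈) v≤u))
          , λ eq → proj₂ (new (placed u∈) u∈) (sym eq))
        u-v : ∀ {u} → u ∈ₗ us → Compatible u (lay′ h′ u) v (lay′ h′ v)
        u-v {u} u∈ = subst₂ (λ a b → Compatible u a v b) (sym (unchanged h′ u∈)) (sym (at-v h′))
          ( (λ _ v≤u → proj₁ (new (placed u∈) u∈) v≤u)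
          , λ _ → Order.trans (proj₁ (before u∈ (here refl))) (l≤r v<n))

    -- Members of layer `h` reach at least to `r b`, hence to `l v`. Rectangles two or more layers
    -- below end before `l b`, hence before `l v`.
    greedy-same : l v ≤ᶠ r b → Greedy (lay [ v ↦ h ]) h b (v ∷ us) vs
    greedy-same v≤b = extend (proj₁ (All.head opener)) b≤v (All.tail opener)
      (λ P _ → (λ v≤u → near-below (highest P) λ lt → older P lt (Order.trans b≤v v≤u))
             , λ eq → Order.trans v≤b (current P eq))
      placed

    -- Rectangles below layer `h` end no later than `b`, while `v` starts beyond `b`; so `v` misses
    -- all those that are now two or more layers below it.
    greedy-new : ¬ (l v ≤ᶠ r b) → Greedy (lay [ v ↦ suc h ]) (suc h) v (v ∷ us) vs
    greedy-new v≰b = extend v<n Order.refl (All.map (v<n ,_) (AllPairs.head sorted))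
      (λ P _ → (λ v≤u → near-below (m≤n⇒m≤1+n (highest P)) λ lt → beyond P lt v≤u)
             , λ eq → contradiction (≤-trans (≤-reflexive (sym eq)) (highest P)) 1+n≰n)
      λ u∈ → let P = placed u∈ in record
        { bounded = bounded P
        ; highest = m≤n⇒m≤1+n (highest P)
        ; current = λ eq → contradiction (≤-trans (≤-reflexive (sym eq)) (highest P)) 1+n≰n
        ; old     = λ _ → mono (bounded P) v<n (proj₁ (before u∈ (here refl)))
        ; older   = beyond P
        }
      where
      beyond : ∀ {u} → Placed lay h b u → suc (lay u) < suc h → ¬ (l v ≤ᶠ r u)
      beyond P (s≤s lt) v≤u = v≰b (Order.trans v≤u (old P lt))

  -- The first rectangle opens layer 0. If there is none, `f k` is an arbitrary entry; this is why
  -- `opener` bounds `b` only in the presence of a rectangle still to come.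
  greedy-start : ∀ {lay f k vs} → Holds f k vs → AllPairs (λ u v → l u ≤ᶠ l v) vs → Unique vs → All (_< n) vs →
                 Greedy lay 0 (f k) [] vs
  greedy-start {f = f} {k} h sorted unique vs<n = record
    { opener = first h sorted vs<n ; placed = λ () ; compatible = λ () ; before = λ ()
    ; sorted = sorted ; unique = unique ; vs<n = vs<n }
    where
    first : ∀ {vs} → Holds f k vs → AllPairs (λ u v → l u ≤ᶠ l v) vs → All (_< n) vs →
            All (λ v → f k < n × l (f k) ≤ᶠ l v) vs
    first []         _       _         = []
    first (refl ∷ _) (v≤ ∷ _) (v<n ∷ _) = (v<n , Order.refl) ∷ All.map (v<n ,_) v≤

-- Assigning the layers and writing the output

layersExit layersStep : ℕ
layersExit = 1 + costᵗ layerTest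
layersStep = 1 + costᵗ layerTest + (1 + costᵗ extendsLayer + (price sameLayer + price newLayer))

emitLayersTest emitEventsTest forgets : Test
emitLayersTest = notᵗ (var 0 ≤ⁿ var 6)
emitEventsTest = notᵗ (var 0 ⊕ var 0 ≤ⁿ var 6)
forgets        = var 0 ≤ⁿ at 0 (var 10 ⊕ var 6)

-- The numbers follow `serialize`: the parent `t` of node `t + 1`, then the blocks of forgotten and
-- of introduced rectangles, one empty and the other a singleton.
emitLayer emitForget emitIntroduce : Program
emitLayer     = emit (at 1 (var 6)) ⨾ 6 ≔ lit 1 ⊕ var 6
emitForget    = emit (var 6) ⨾ emit (lit 1) ⨾ emit (at 0 (var 10 ⊕ var 6) ⊖ var 0) ⨾ emit (lit 0) ⨾ 6 ≔ lit 1 ⊕ var 6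
emitIntroduce = emit (var 6) ⨾ emit (lit 0) ⨾ emit (lit 1) ⨾ emit (at 0 (var 10 ⊕ var 6)) ⨾ 6 ≔ lit 1 ⊕ var 6

emitLayers emitEvents : Program
emitLayers = while emitLayersTest emitLayer
emitEvents = while emitEventsTest (ifᵖ forgets emitForget emitIntroduce)

emitLayersExit emitLayersStep emitEventsExit emitEventsStep : ℕ
emitLayersExit = 1 + costᵗ emitLayersTest
emitLayersStep = 1 + costᵗ emitLayersTest + price emitLayer
emitEventsExit = 1 + costᵗ emitEventsTest
emitEventsStep = 1 + costᵗ emitEventsTest + (1 + costᵗ forgets + (price emitForget + price emitIntroduce))

-- The serialization of a node that differs from its parent by event e.
encode : ℕ → ℕ → List ℕ
encode n e = if n ≤ᵇ e then 1 ∷ e ∸ n ∷ 0 ∷ [] else 0 ∷ 1 ∷ e ∷ []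

module Loops {c ℓ₁ ℓ₂} (F : OrderedField c ℓ₁ ℓ₂) where
  open OrderedField F using (Carrier; module Order) renaming (_≤_ to _≤ᶠ_)
  open Machine F

  module _ (n : ℕ) (ρ : ℕ → ℕ → Carrier)
      (l≤r : ∀ {u} → u < n → ρ 0 u ≤ᶠ ρ 2 u)
      (mono : ∀ {u v} → u < n → v < n → ρ 0 u ≤ᶠ ρ 0 v → ρ 2 u ≤ᶠ ρ 2 v) where
    open GreedyLayers F n (ρ 0) (ρ 2) l≤r mono

    record LayersReady (us vs : List ℕ) (s : Store F) : Set (c ⊔ ℓ₂) where
      field
        in-holds : Holds (arr s 0) (reg s 1) vs
        in-end   : reg s 2 ≡ reg s 1 + length vs
        greedy   : Greedy (arr s 1) (reg s 11) (reg s 12) us vs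
        reals    : arrʳ s ≡ ρ

    keptᴸ : Store F → ℕ × ℕ × (ℕ → ℕ) × List ℕ
    keptᴸ s = reg s 0 , reg s 10 , arr s 0 , out s

    record Layered (xs : List ℕ) (s s′ : Store F) : Set (c ⊔ ℓ₂) where
      field
        compatible : ∀ {u v} → u ∈ₗ xs → v ∈ₗ xs → Compatible u (arr s′ 1 u) v (arr s′ 1 v)
        kept       : keptᴸ s′ ≡ keptᴸ s

    -- Fixing `xs` keeps the postcondition constant during the recursion; once `vs` is empty,
    -- `cover` places all of `xs` among the rectangles already treated.
    assignLayers-correct : ∀ us vs {s xs} → (∀ {x} → x ∈ₗ xs → x ∈ₗ us ⊎ x ∈ₗ vs) → LayersReady us vs s →
      Exec assignLayers s (layersExit + length vs * layersStep) (Layered xs s)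
    assignLayers-correct us [] {s} cover R =
      within-≤ (≤-reflexive (sym (+-identityʳ layersExit))) (while-false {s = s} {b = layerTest}
        (cong not (≤ᵇ-true (≤-reflexive (trans in-end (+-identityʳ _)))))
        (record { compatible = λ u∈ v∈ → Greedy.compatible greedy (done u∈) (done v∈) ; kept = refl }))
      where
      open LayersReady R
      done : ∀ {x} → x ∈ₗ _ → x ∈ₗ us
      done x∈ = [ id , (λ ()) ]′ (cover x∈)
    assignLayers-correct us (v ∷ vs) {s} {xs} cover
        record { in-holds = refl ∷ h ; in-end = in-end ; greedy = greedy ; reals = refl } =
      within-≤ (≤-reflexive (loop-cost layersStep (length vs) layersExit)) (while-true {s = s} {b = layerTest}
        (cong not (≤ᵇ-false (≤-trans (s≤s (m≤m+n _ (length vs))) (≤-reflexive (sym in-end′)))))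
        (place (ρ 0 v Order.≤? ρ 2 (reg s 12)) refl))
      where
      in-end′ = trans in-end (+-suc (reg s 1) (length vs))
      cover′ : ∀ {x} → x ∈ₗ xs → x ∈ₗ v ∷ us ⊎ x ∈ₗ vs
      cover′ x∈ with cover x∈
      ... | inj₁ x∈us         = inj₁ (there x∈us)
      ... | inj₂ (here eq)    = inj₁ (here eq)
      ... | inj₂ (there x∈vs) = inj₂ x∈vs
      finish : ∀ {s₁ s′} → keptᴸ s₁ ≡ keptᴸ s → Layered xs s₁ s′ → Layered xs s s′
      finish eq Y = record { compatible = Layered.compatible Y ; kept = trans (Layered.kept Y) eq }
      place : (d : Dec (ρ 0 v ≤ᶠ ρ 2 (reg s 12))) → does (ρ 0 v Order.≤? ρ 2 (reg s 12)) ≡ does d →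
        Exec (ifᵖ extendsLayer sameLayer newLayer) s (1 + costᵗ extendsLayer + (price sameLayer + price newLayer))
          (λ s₁ → Exec assignLayers s₁ (layersExit + length vs * layersStep) (Layered xs s))
      place (yes v≤b) eq = if-true {b = extendsLayer} eq (line sameLayer (map-post (finish refl)
        (assignLayers-correct (v ∷ us) vs cover′ record
          { in-holds = h ; in-end = in-end′ ; greedy = greedy-same greedy v≤b ; reals = refl })))
      place (no v≰b) eq = if-false {b = extendsLayer} {B = price sameLayer} eq (line newLayer (map-post (finish refl)
        (assignLayers-correct (v ∷ us) vs cover′ record
          { in-holds = h ; in-end = in-end′ ; greedy = greedy-new greedy v≰b ; reals = refl })))

  keptᴱ : Store F → ℕ × ℕ × (ℕ → ℕ) × (ℕ → ℕ)
  keptᴱ s = reg s 0 , reg s 10 , arr s 0 , arr s 1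

  Emitted : List ℕ → Store F → Store F → Set
  Emitted xs s s′ = out s′ ≡ out s ++ xs × keptᴱ s′ ≡ keptᴱ s

  emitLayers-correct : ∀ r {f s} → (∀ x → f x ≡ arr s 1 (reg s 6 + x)) → reg s 0 ≡ reg s 6 + r →
    Exec emitLayers s (emitLayersExit + r * emitLayersStep) (Emitted (applyUpTo f r) s)
  emitLayers-correct zero {s = s} _ e =
    within-≤ (≤-reflexive (sym (+-identityʳ emitLayersExit))) (while-false {s = s} {b = emitLayersTest}
      (cong not (≤ᵇ-true (≤-reflexive (trans e (+-identityʳ _))))) (sym (++-identityʳ _) , refl))
  emitLayers-correct (suc r) {f} {s} fx e =
    within-≤ (≤-reflexive (loop-cost emitLayersStep r emitLayersExit)) (while-true {s = s} {b = emitLayersTest}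
      (cong not (≤ᵇ-false (≤-trans (s≤s (m≤m+n _ r)) (≤-reflexive (sym e′)))))
      (line emitLayer (map-post (λ {s′} → extend {s′})
        (emitLayers-correct r (λ x → trans (fx (suc x)) (cong (arr s 1) (+-suc (reg s 6) x))) e′))))
    where
    e′ = trans e (+-suc (reg s 6) r)
    extend : ∀ {s′} → Emitted (applyUpTo (f ∘ suc) r) (effect emitLayer s) s′ → Emitted (applyUpTo f (suc r)) s s′
    extend (eq , k) = trans eq (trans (++-assoc (out s) _ _)
      (cong (λ x → out s ++ x ∷ applyUpTo (f ∘ suc) r) (sym (trans (fx 0) (cong (arr s 1) (+-identityʳ _)))))) , k

  emitEvents-correct : ∀ r {f s} →
    (∀ x → f x ≡ (reg s 6 + x) ∷ encode (reg s 0) (arr s 0 (reg s 10 + (reg s 6 + x)))) →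
    reg s 0 + reg s 0 ≡ reg s 6 + r →
    Exec emitEvents s (emitEventsExit + r * emitEventsStep) (Emitted (concat (applyUpTo f r)) s)
  emitEvents-correct zero {s = s} _ e =
    within-≤ (≤-reflexive (sym (+-identityʳ emitEventsExit))) (while-false {s = s} {b = emitEventsTest}
      (cong not (≤ᵇ-true (≤-reflexive (trans e (+-identityʳ _))))) (sym (++-identityʳ _) , refl))
  emitEvents-correct (suc r) {f} {s} fx e =
    within-≤ (≤-reflexive (loop-cost emitEventsStep r emitEventsExit)) (while-true {s = s} {b = emitEventsTest}
      (cong not (≤ᵇ-false (≤-trans (s≤s (m≤m+n _ r)) (≤-reflexive (sym e′)))))
      (by-kind _ refl))
    where
    e′ = trans e (+-suc (reg s 6) r)
    code = arr s 0 (reg s 10 + reg s 6)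
    rest = concat (applyUpTo (f ∘ suc) r)

    fx′ : ∀ x → f (suc x) ≡ (suc (reg s 6) + x) ∷ encode (reg s 0) (arr s 0 (reg s 10 + (suc (reg s 6) + x)))
    fx′ x = trans (fx (suc x)) (cong (λ i → i ∷ encode (reg s 0) (arr s 0 (reg s 10 + i))) (+-suc (reg s 6) x))

    fx₀ : f 0 ≡ reg s 6 ∷ encode (reg s 0) code
    fx₀ = trans (fx 0) (cong (λ i → i ∷ encode (reg s 0) (arr s 0 (reg s 10 + i))) (+-identityʳ (reg s 6)))

    four : ∀ (o : List ℕ) a b d e ys → (o ∷ʳ a ∷ʳ b ∷ʳ d ∷ʳ e) ++ ys ≡ o ++ (a ∷ b ∷ d ∷ e ∷ ys)
    four o a b d e ys = trans (++-assoc (o ∷ʳ a ∷ʳ b ∷ʳ d) _ _) (trans (++-assoc (o ∷ʳ a ∷ʳ b) _ _)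
                          (trans (++-assoc (o ∷ʳ a) _ _) (++-assoc o _ _)))

    by-kind : ∀ b → (reg s 0 ≤ᵇ code) ≡ b →
      Exec (ifᵖ forgets emitForget emitIntroduce) s (1 + costᵗ forgets + (price emitForget + price emitIntroduce))
        (λ s₁ → Exec emitEvents s₁ (emitEventsExit + r * emitEventsStep) (Emitted (concat (applyUpTo f (suc r))) s))
    by-kind true eq = if-true {b = forgets} eq (line emitForget (map-post
      (λ (eq′ , k) → trans eq′ (trans (four (out s) _ _ _ _ rest) (cong (λ xs → out s ++ xs ++ rest) (sym first))) , k)
      (emitEvents-correct r fx′ e′)))
      where
      first : f 0 ≡ reg s 6 ∷ 1 ∷ code ∸ reg s 0 ∷ 0 ∷ []
      first = trans fx₀ (cong (λ b → reg s 6 ∷ (if b then 1 ∷ code ∸ reg s 0 ∷ 0 ∷ [] else 0 ∷ 1 ∷ code ∷ [])) eq)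
    by-kind false eq = if-false {b = forgets} {B = price emitForget} eq (line emitIntroduce (map-post
      (λ (eq′ , k) → trans eq′ (trans (four (out s) _ _ _ _ rest) (cong (λ xs → out s ++ xs ++ rest) (sym first))) , k)
      (emitEvents-correct r fx′ e′)))
      where
      first : f 0 ≡ reg s 6 ∷ 0 ∷ 1 ∷ code ∷ []
      first = trans fx₀ (cong (λ b → reg s 6 ∷ (if b then 1 ∷ code ∸ reg s 0 ∷ 0 ∷ [] else 0 ∷ 1 ∷ code ∷ [])) eq)

-- From the sorted tape to the decomposition

sortEvents sortLefts layerSetup afterEvents emitHeader : Program
sortEvents  = SortProgram.sort eventCompare
sortLefts   = SortProgram.sort leftCompare
-- Register 10 remembers where the sorted events begin, since the second sort reuses register 1.
afterEvents = 10 ≔ var 1 ⨾ 3 ≔ var 0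
layerSetup  = 11 ≔ lit 0 ⨾ 12 ≔ at 0 (var 1)
-- The number of nodes besides the root, followed by the empty block of the root bag.
emitHeader  = emit (var 0 ⊕ var 0) ⨾ emit (lit 0) ⨾ 6 ≔ lit 0

orderPhase layerPhase emitPhase main : Program
orderPhase = 3 ≔ var 0 ⊕ var 0 ⨾ sortEvents ⨾ afterEvents
layerPhase = sortLefts ⨾ layerSetup ⨾ assignLayers
emitPhase  = 6 ≔ lit 0 ⨾ emitLayers ⨾ emitHeader ⨾ emitEvents
main       = orderPhase ⨾ layerPhase ⨾ emitPhase

orderTime layerTime emitTime mainTime : ℕ → ℕ
orderTime n = 4 + (SortProgram.sortCost eventCompare (n + n) + price afterEvents)
layerTime n = SortProgram.sortCost leftCompare n + (price layerSetup + (layersExit + n * layersStep))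
emitTime n  = 2 + ((emitLayersExit + n * emitLayersStep) + (price emitHeader + (emitEventsExit + (n + n) * emitEventsStep)))
mainTime n  = orderTime n + (layerTime n + emitTime n)

tabulate-toℕ : ∀ {a} {A : Set a} n (f : ℕ → A) → tabulate {n = n} (f ∘ toℕ) ≡ applyUpTo f n
tabulate-toℕ zero    f = refl
tabulate-toℕ (suc n) f = cong (f 0 ∷_) (tabulate-toℕ n (f ∘ suc))

module _ {a} {A : Set a} {b : Bool} {x y : A} where

  if-true≡ : b ≡ true → (if b then x else y) ≡ x
  if-true≡ refl = refl

  if-false≡ : b ≡ false → (if b then x else y) ≡ y
  if-false≡ refl = refl

module InputProperties {c ℓ₁ ℓ₂} (F : OrderedField c ℓ₁ ℓ₂) {n} (R : UnitWidthFamily F n) where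
  open Coordinates F R
  open Machine F
  private module Ring = CommutativeRing (OrderedField.commutativeRing F)

  ρ : ℕ → ℕ → Carrier
  ρ = arrʳ (input F R)

  coordinate : ∀ (j : Fin 8) v → ρ (toℕ j) (toℕ v) ≡ Vec.lookup (coordinates F (rect v)) j
  coordinate j v with toℕ j <? 8 | toℕ v <? n
  ... | yes j<8 | yes v<n rewrite Finₚ.fromℕ<-toℕ j j<8 | Finₚ.fromℕ<-toℕ v v<n = refl
  ... | no j≮8  | _       = contradiction (Finₚ.toℕ<n j) j≮8
  ... | yes _   | no v≮n  = contradiction (Finₚ.toℕ<n v) v≮n

  -- Add the common width to both sides.
  right-mono : ∀ u v → left u ≤ᶠ left v → right u ≤ᶠ right v
  right-mono u v u≤v =
    Order.≤-respˡ-≈ (restore (left u) (right u))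
      (Order.≤-respʳ-≈ (Ring.trans (Ring.+-cong Ring.refl (sameWidth u v)) (restore (left v) (right v)))
        (OrderedField.+-monoˡ-≤ F (right u Ring.- left u) u≤v))
    where
    restore : ∀ x y → x Ring.+ (y Ring.- x) ≈ y
    restore x y = Ring.trans (Ring.sym (Ring.+-assoc x y (Ring.- x))) (xyx⁻¹≈y Ring.+-abelianGroup x y)

  at-index : ∀ {p} {P : ℕ → Set p} {u} → u < n → (∀ v → P (toℕ v)) → P u
  at-index {P = P} u<n f = subst P (Finₚ.toℕ-fromℕ< u<n) (f (fromℕ< u<n))

  l≤r : ∀ {u} → u < n → ρ 0 u ≤ᶠ ρ 2 u
  l≤r u<n = at-index {P = λ u → ρ 0 u ≤ᶠ ρ 2 u} u<n λ v →
    subst₂ _≤ᶠ_ (sym (coordinate 0F v)) (sym (coordinate 2F v)) (left≤right v)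

  mono : ∀ {u v} → u < n → v < n → ρ 0 u ≤ᶠ ρ 0 v → ρ 2 u ≤ᶠ ρ 2 v
  mono u<n v<n = at-index {P = λ u → ρ 0 u ≤ᶠ ρ 0 _ → ρ 2 u ≤ᶠ ρ 2 _} u<n λ u →
    at-index {P = λ v → ρ 0 (toℕ u) ≤ᶠ ρ 0 v → ρ 2 (toℕ u) ≤ᶠ ρ 2 v} v<n λ v u≤v →
    subst₂ _≤ᶠ_ (sym (coordinate 2F u)) (sym (coordinate 2F v))
      (right-mono u v (subst₂ _≤ᶠ_ (coordinate 0F u) (coordinate 0F v) u≤v))

module Assembly {c ℓ₁ ℓ₂} (F : OrderedField c ℓ₁ ℓ₂) {n} (R : UnitWidthFamily F n) where
  open Coordinates F R
  open InputProperties F R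
  open Orders F
  open GreedyLayers F n (ρ 0) (ρ 2) l≤r mono using (Compatible)

  _⊑_ : ℕ → ℕ → Set ℓ₂
  d ⊑ e = side ρ n d ≼ side ρ n e

  data View : Fin (n + n) → Fin n ⊎ Fin n → Set where
    lower : ∀ v → View (v ↑ˡ n) (inj₁ v)
    upper : ∀ v → View (n ↑ʳ v) (inj₂ v)

  view : ∀ e → View e (splitAt n e)
  view e with splitAt n e in eq
  ... | inj₁ v with refl ← Finₚ.splitAt⁻¹-↑ˡ eq = lower v
  ... | inj₂ v with refl ← Finₚ.splitAt⁻¹-↑ʳ {m = n} eq = upper v

  lower-code : ∀ (v : Fin n) → (n ≤ᵇ toℕ (v ↑ˡ n)) ≡ false
  lower-code v = ≤ᵇ-false (subst (_< n) (sym (Finₚ.toℕ-↑ˡ v n)) (Finₚ.toℕ<n v))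

  upper-code : ∀ (v : Fin n) → (n ≤ᵇ toℕ (n ↑ʳ v)) ≡ true
  upper-code v = ≤ᵇ-true (subst (n ≤_) (sym (Finₚ.toℕ-↑ʳ n v)) (m≤m+n n (toℕ v)))

  upper-∸ : ∀ (v : Fin n) → toℕ (n ↑ʳ v) ∸ n ≡ toℕ v
  upper-∸ v = trans (cong (_∸ n) (Finₚ.toℕ-↑ʳ n v)) (m+n∸m≡n n (toℕ v))

  side-event : ∀ {e x} → View e x → side ρ n (toℕ e) ≡ Sum.map bottom top x
  side-event (lower v) = trans (if-false≡ (lower-code v)) (cong inj₁ (trans (cong (ρ 1) (Finₚ.toℕ-↑ˡ v n)) (coordinate 1F v)))
  side-event (upper v) = trans (if-true≡ (upper-code v)) (cong inj₂ (trans (cong (ρ 5) (upper-∸ v)) (coordinate 5F v)))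

  blockOf : List (Fin n) → List ℕ
  blockOf vs = length vs ∷ map toℕ vs

  encode-event : ∀ {e x} → View e x →
    encode n (toℕ e) ≡ blockOf ([ (λ _ → []) , [_] ]′ x) ++ blockOf ([ [_] , (λ _ → []) ]′ x)
  encode-event (lower v) = trans (if-false≡ (lower-code v)) (cong (λ k → 0 ∷ 1 ∷ k ∷ []) (Finₚ.toℕ-↑ˡ v n))
  encode-event (upper v) = trans (if-true≡ (upper-code v)) (cong (λ k → 1 ∷ k ∷ 0 ∷ []) (upper-∸ v))

  -- The result of the computation with the store reduced to two arrays and a position; the
  -- combinatorial part sees nothing else of the machine.
  record Solved (lay tape : ℕ → ℕ) (base : ℕ) : Set (c ⊔ ℓ₂) where
    field
      zs         : List ℕ
      perm       : zs ↭ upTo (n + n)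
      sorted     : AllPairs _⊑_ zs
      zs-holds   : Holds tape base zs
      compatible : ∀ {u v} → u ∈ₗ upTo n → v ∈ₗ upTo n → Compatible u (lay u) v (lay v)

  expected : (lay tape : ℕ → ℕ) (base : ℕ) → List ℕ
  expected lay tape base = applyUpTo lay n ++ (n + n) ∷ 0 ∷ concat (applyUpTo (λ t → t ∷ encode n (tape (base + t))) (n + n))

  module FromSolved {lay tape base} (S : Solved lay tape base) where
    open Solved S

    length-zs : length zs ≡ n + n
    length-zs = trans (↭-length perm) (length-applyUpTo id (n + n))

    in-range : ∀ (t : Fin (n + n)) → toℕ t < length zs
    in-range t = subst (toℕ t <_) (sym length-zs) (Finₚ.toℕ<n t)

    code< : ∀ (t : Fin (n + n)) → tape (base + toℕ t) < n + n
    code< t = holds-All zs-holds (All-resp-↭ (↭-sym perm) (Allₚ.all-upTo (n + n))) (in-range t)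

    code : Fin (n + n) → Fin (n + n)
    code t = fromℕ< (code< t)

    toℕ-code : ∀ t → toℕ (code t) ≡ tape (base + toℕ t)
    toℕ-code t = Finₚ.toℕ-fromℕ< (code< t)

    events : Fin (n + n) → Fin n ⊎ Fin n
    events t = splitAt n (code t)

    events-ordered : ∀ {s t} → toℕ s < toℕ t → Sum.map bottom top (events s) ≼ Sum.map bottom top (events t)
    events-ordered {s} {t} s<t = subst₂ _≼_ (side-of s) (side-of t) (holds-AllPairs zs-holds sorted s<t (in-range t))
      where
      side-of : ∀ t → side ρ n (tape (base + toℕ t)) ≡ Sum.map bottom top (events t)
      side-of t = trans (cong (side ρ n) (sym (toℕ-code t))) (side-event (view (code t)))

    events-occur : ∀ e → ∃ λ t → events t ≡ e
    events-occur e with i , i< , eq ← holds-∈ zs-holds (∈-resp-↭ (↭-sym perm) (∈-upTo⁺ (Finₚ.toℕ<n (join n n e)))) =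
      t , trans (cong (splitAt n) code≡) (Finₚ.splitAt-join n n e)
      where
      i<m = subst (i <_) length-zs i<
      t = fromℕ< i<m
      code≡ : code t ≡ join n n e
      code≡ = Finₚ.toℕ-injective (trans (toℕ-code t) (trans (cong (λ j → tape (base + j)) (Finₚ.toℕ-fromℕ< i<m)) eq))

    compatibleᶠ : ∀ u v → Compatible (toℕ u) (lay (toℕ u)) (toℕ v) (lay (toℕ v))
    compatibleᶠ u v = compatible (∈-upTo⁺ (Finₚ.toℕ<n u)) (∈-upTo⁺ (Finₚ.toℕ<n v))

    sweep : Sweep F R (n + n)
    sweep = record
      { event        = events
      ; occurs       = events-occur
      -- For events of different kinds `≼` unfolds to exactly the two conditions: `≤` when the lower
      -- side comes first, a negated `≤` when the upper side does.
      ; intro-forget = λ {s} {t} s<t eq eq′ → subst₂ (λ x y → Sum.map bottom top x ≼ Sum.map bottom top y) eq eq′ (events-ordered s<t)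
      ; forget-intro = λ {s} {t} s<t eq eq′ → subst₂ (λ x y → Sum.map bottom top x ≼ Sum.map bottom top y) eq eq′ (events-ordered s<t)
      ; lay          = lay ∘ toℕ
      ; near         = λ u v p q → proj₁ (compatibleᶠ u v)
                         (subst₂ _≤ᶠ_ (sym (coordinate 0F u)) (sym (coordinate 2F v)) p)
                         (subst₂ _≤ᶠ_ (sym (coordinate 0F v)) (sym (coordinate 2F u)) q)
      ; same         = λ u v eq → subst₂ _≤ᶠ_ (coordinate 0F u) (coordinate 2F v) (proj₂ (compatibleᶠ u v) eq)
      }

    open Decomposition F sweep using (description)

    serialize-expected : expected lay tape base ≡ Description.serialize description
    serialize-expected = sym (cong₂ (λ xs ys → xs ++ (n + n) ∷ 0 ∷ ys) (tabulate-toℕ n lay)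
      (cong concat (trans (tabulate-cong node) (tabulate-toℕ (n + n) (λ t → t ∷ encode n (tape (base + t)))))))
      where
      node : ∀ t → toℕ (inject₁ t) ∷ blockOf (Description.forget description t) ++ blockOf (Description.introduce description (suc t))
             ≡ toℕ t ∷ encode n (tape (base + toℕ t))
      node t = cong₂ _∷_ (Finₚ.toℕ-inject₁ t)
        (trans (sym (encode-event (view (code t)))) (cong (encode n) (toℕ-code t)))

-- Correctness and running time

module Correctness {c ℓ₁ ℓ₂} (F : OrderedField c ℓ₁ ℓ₂) {n} (R : UnitWidthFamily F n) where
  open Coordinates F R
  open InputProperties F R
  open Assembly F R
  open Machine F
  open Orders F
  open Loops F
  open GreedyLayers F n (ρ 0) (ρ 2) l≤r mono using (greedy-start)

  private
    module Events = Sorting F eventCompare _⊑_ (λ d e → side ρ n d ≼? side ρ n e)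
      (λ d e → ≼-total (side ρ n d) (side ρ n e))
      (λ {d} {e} {f} → ≼-trans (side ρ n d) (side ρ n e) (side ρ n f))

    module Lefts = Sorting F leftCompare (λ u v → ρ 0 u ≤ᶠ ρ 0 v) (λ u v → ρ 0 u Order.≤? ρ 0 v)
      (λ u v → Order.total (ρ 0 u) (ρ 0 v)) Order.trans

  record EventsReady (s : Store F) : Set (c ⊔ ℓ₂) where
    field
      zs       : List ℕ
      perm     : zs ↭ upTo (n + n)
      sorted   : AllPairs _⊑_ zs
      zs-holds : Holds (arr s 0) (reg s 10) zs
      zs-below : reg s 10 + length zs ≤ reg s 2
      number   : reg s 0 ≡ n
      size     : reg s 3 ≡ n
      reals    : arrʳ s ≡ ρ
      silent   : out s ≡ []

  orderPhase-correct : Exec orderPhase (input F R) (orderTime n) EventsReady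
  orderPhase-correct = line-then (3 ≔ var 0 ⊕ var 0)
    (Events.sort-correct {φ = contextOf s₁} eventCompare-≼ {n + n} {s₁} refl refl then λ S → line afterEvents (ready S))
    where
    s₁ = effect (3 ≔ var 0 ⊕ var 0) (input F R)
    ready : ∀ {s} → Events.Sorted {φ = contextOf s₁} eventCompare-≼ (upTo (n + n)) s₁ s → EventsReady (effect afterEvents s)
    ready S = record
      { zs = zs ; perm = perm ; sorted = sorted ; zs-holds = out-holds
      ; zs-below = ≤-reflexive (sym out-end)
      ; number = number ; size = number
      ; reals  = cong Context.reals ctx
      ; silent = cong Context.output ctx }
      where
      open Events.Sorted S
      number = cong Context.reg0 ctx

  record LayersDone (s : Store F) : Set (c ⊔ ℓ₂) where
    field
      solved : Solved (arr s 1) (arr s 0) (reg s 10)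
      number : reg s 0 ≡ n
      silent : out s ≡ []

  layerPhase-correct : ∀ {s} → EventsReady s → Exec layerPhase s (layerTime n) LayersDone
  layerPhase-correct {s} E = Lefts.sort-correct compare {n} {s} refl E.size then λ S → line-then layerSetup (layers S)
    where
    module E = EventsReady E
    compare : ∀ s′ → contextOf s′ ≡ contextOf s → ∀ d e →
      evalᵗ F s′ (leftCompare d e) ≡ does (ρ 0 (evalⁿ F s′ d) Order.≤? ρ 0 (evalⁿ F s′ e))
    compare s′ eq d e = cong (λ ρ → does (ρ 0 (evalⁿ F s′ d) Order.≤? ρ 0 (evalⁿ F s′ e)))
      (trans (cong Context.reals eq) E.reals)

    layers : ∀ {s₁} → Lefts.Sorted compare (upTo n) s s₁ →
      Exec assignLayers (effect layerSetup s₁) (layersExit + n * layersStep) LayersDone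
    layers {s₁} S = map-post finish (within-≤ (≤-reflexive (cong (λ l → layersExit + l * layersStep) length-zs))
      (assignLayers-correct n ρ l≤r mono [] S.zs (λ x∈ → inj₂ (∈-resp-↭ (↭-sym S.perm) x∈)) ready))
      where
      module S = Lefts.Sorted S
      length-zs : length S.zs ≡ n
      length-zs = trans (↭-length S.perm) (length-applyUpTo id n)
      s₂ = effect layerSetup s₁
      ready : LayersReady n ρ l≤r mono [] S.zs s₂
      ready = record
        { in-holds = S.out-holds
        ; in-end   = S.out-end
        ; greedy   = greedy-start S.out-holds S.sorted
                       (Permutation.Unique-resp-↭ (setoid ℕ) (↭⇒↭ₛ (↭-sym S.perm)) (upTo⁺ n))
                       (All-resp-↭ (↭-sym S.perm) (Allₚ.all-upTo n))
        ; reals    = trans (cong Context.reals S.ctx) E.reals }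
      finish : ∀ {s′} → Layered n ρ l≤r mono (upTo n) s₂ s′ → LayersDone s′
      finish {s′} Y = record
        { solved = record { zs = E.zs ; perm = E.perm ; sorted = E.sorted ; compatible = Layered.compatible Y
                          -- The sorted events lie below the position at which the second sort
                          -- starts to write, and assigning layers does not touch the tape.
                          ; zs-holds = subst₂ (λ f k → Holds f k E.zs) (sym tape) (sym base)
                              (holds-agree E.zs-holds E.zs-below S.unchanged) }
        ; number = trans (cong proj₁ kept) (trans (cong Context.reg0 S.ctx) E.number)
        ; silent = trans (cong (proj₂ ∘ proj₂ ∘ proj₂) kept) (trans (cong Context.output S.ctx) E.silent) }
        where
        kept = Layered.kept Y
        tape : arr s′ 0 ≡ arr s₁ 0
        tape = cong (proj₁ ∘ proj₂ ∘ proj₂) kept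
        base : reg s′ 10 ≡ reg s 10
        base = trans (cong (proj₁ ∘ proj₂) kept) (cong Context.reg10 S.ctx)

  emitPhase-correct : ∀ {s} → reg s 0 ≡ n → out s ≡ [] →
    Exec emitPhase s (emitTime n) (λ s′ → out s′ ≡ expected (arr s 1) (arr s 0) (reg s 10))
  emitPhase-correct {s} number silent = line-then (6 ≔ lit 0)
    (emitLayers-correct n {arr s 1} {s₁} (λ _ → refl) number then λ {s₂} E → line-then emitHeader
      (map-post (λ {s′} → finish s₂ E {s′}) (emitEvents-correct (n + n) {record-at} {effect emitHeader s₂} (records s₂ E) (size s₂ E))))
    where
    s₁ = effect (6 ≔ lit 0) s
    record-at : ℕ → List ℕ
    record-at t = t ∷ encode n (arr s 0 (reg s 10 + t))
    module _ s₂ (E : Emitted (applyUpTo (arr s 1) n) s₁ s₂) where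
      number₂ : reg s₂ 0 ≡ n
      number₂ = trans (cong proj₁ (proj₂ E)) number
      size : reg s₂ 0 + reg s₂ 0 ≡ n + n
      size = cong₂ _+_ number₂ number₂
      records : ∀ t → record-at t ≡ t ∷ encode (reg s₂ 0) (arr s₂ 0 (reg s₂ 10 + t))
      records t = trans (cong (λ k → t ∷ encode k (arr s 0 (reg s 10 + t))) (sym number))
        (sym (cong (λ (k , b , f , _) → t ∷ encode k (f (b + t))) (proj₂ E)))
      finish : ∀ {s′} → Emitted (concat (applyUpTo record-at (n + n))) (effect emitHeader s₂) s′ →
               out s′ ≡ expected (arr s 1) (arr s 0) (reg s 10)
      finish (eq , _) = trans eq (trans (cong (_++ rest) (++-assoc (out s₂) _ _))
        (trans (++-assoc (out s₂) _ _) (cong₂ (λ o k → o ++ k ∷ 0 ∷ rest)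
          (trans (proj₁ E) (cong (_++ applyUpTo (arr s 1) n) silent)) size)))
        where rest = concat (applyUpTo record-at (n + n))

  main-correct : Exec main (input F R) (mainTime n) λ s →
    ∃ λ lay → ∃₂ λ tape base → Solved lay tape base × out s ≡ expected lay tape base
  main-correct = orderPhase-correct then λ E → layerPhase-correct E then λ {s} L → map-post
    (λ eq → arr s 1 , arr s 0 , reg s 10 , LayersDone.solved L , eq)
    (emitPhase-correct (LayersDone.number L) (LayersDone.silent L))

-- Asymptotic bounds

nlogn : ℕ → ℕ
nlogn n = n * ⌈log₂ n ⌉

∈O-+ : ∀ {f g h} → f ∈O h → g ∈O h → (λ n → f n + g n) ∈O h
∈O-+ {h = h} (C , N , f≤) (C′ , N′ , g≤) = C + C′ , N + N′ , λ n N+N′≤n →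
  ≤-trans (+-mono-≤ (f≤ n (≤-trans (m≤m+n N N′) N+N′≤n)) (g≤ n (≤-trans (m≤n+m N′ N) N+N′≤n)))
          (≤-reflexive (sym (*-distribʳ-+ (h n) C C′)))

1≤log : ∀ {n} → 2 ≤ n → 1 ≤ ⌈log₂ n ⌉
1≤log 2≤n = ⌈log₂⌉-mono-≤ 2≤n

-- The threshold is 2 because `nlogn 1` is 0.
linear∈O : ∀ k → (λ n → n * k) ∈O nlogn
linear∈O k = k , 2 , λ n 2≤n → ≤-trans (≤-reflexive (*-comm n k))
  (*-monoʳ-≤ k (≤-trans (≤-reflexive (sym (*-identityʳ n))) (*-monoʳ-≤ n (1≤log 2≤n))))

const∈O : ∀ k → (λ _ → k) ∈O nlogn
const∈O k = k , 2 , λ n 2≤n → ≤-trans (≤-reflexive (sym (*-identityʳ k)))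
  (*-monoʳ-≤ k (*-mono-≤ (≤-trans (s≤s z≤n) 2≤n) (1≤log 2≤n)))

passes∈O : ∀ a b → (λ n → ⌈log₂ n ⌉ * (a + n * b)) ∈O nlogn
passes∈O a b = a + b , 1 , λ n 1≤n → ≤-trans
  (*-monoʳ-≤ ⌈log₂ n ⌉ (+-monoˡ-≤ (n * b) (≤-trans (≤-reflexive (sym (*-identityˡ a))) (*-monoˡ-≤ a 1≤n))))
  (≤-reflexive (regroup n ⌈log₂ n ⌉ a b))
  where
  regroup : ∀ n l a b → l * (n * a + n * b) ≡ (a + b) * (n * l)
  regroup = solve-∀

-- Passing from `n` to `n + n` doubles the first factor of `nlogn` and, from `n = 2` on, at most
-- doubles the logarithm; hence the factor 4.
doubled∈O : ∀ {f} → f ∈O nlogn → (λ n → f (n + n)) ∈O nlogn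
doubled∈O {f} (C , N , f≤) = C * 4 , N + 2 , bound
  where
  regroup : ∀ C n l → C * ((n + n) * (l + l)) ≡ C * 4 * (n * l)
  regroup = solve-∀
  bound : ∀ n → N + 2 ≤ n → f (n + n) ≤ C * 4 * nlogn n
  bound n@(suc _) N+2≤n = ≤-trans (f≤ (n + n) (≤-trans (m≤m+n N 2) (≤-trans N+2≤n (m≤m+n n n))))
    (≤-trans (*-monoʳ-≤ C (*-monoʳ-≤ (n + n) (≤-trans (≤-reflexive log-double) (+-monoˡ-≤ ⌈log₂ n ⌉ (1≤log (≤-trans (m≤n+m 2 N) N+2≤n))))))
             (≤-reflexive (regroup C n ⌈log₂ n ⌉)))
    where
    log-double : ⌈log₂ (n + n) ⌉ ≡ 1 + ⌈log₂ n ⌉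
    log-double = trans (cong (λ k → ⌈log₂ (n + k) ⌉) (sym (+-identityʳ n))) (⌈log₂2*n⌉≡1+⌈log₂n⌉ n)
  bound zero N+2≤0 = contradiction (≤-trans (m≤n+m 2 N) N+2≤0) λ ()

sortCost∈O : ∀ compare → SortProgram.sortCost compare ∈O nlogn
sortCost∈O compare = ∈O-+ (const∈O (price fillSetup)) (∈O-+ (∈O-+ (const∈O fillExit) (linear∈O fillStep))
  (∈O-+ (const∈O 2) (∈O-+ (const∈O passesExit) (passes∈O passesOverhead passStep))))
  where open SortProgram compare

mainTime∈O : mainTime ∈O nlogn
mainTime∈O = ∈O-+
  (∈O-+ (const∈O 4) (∈O-+ (doubled∈O (sortCost∈O eventCompare)) (const∈O (price afterEvents))))
  (∈O-+ (∈O-+ (sortCost∈O leftCompare) (∈O-+ (const∈O (price layerSetup)) (∈O-+ (const∈O layersExit) (linear∈O layersStep))))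
        (∈O-+ (const∈O 2) (∈O-+ (∈O-+ (const∈O emitLayersExit) (linear∈O emitLayersStep))
          (∈O-+ (const∈O (price emitHeader)) (∈O-+ (const∈O emitEventsExit) (doubled∈O (linear∈O emitEventsStep)))))))

theorem4p12 : ∀ {c ℓ₁ ℓ₂} (F : OrderedField c ℓ₁ ℓ₂) →
    (Σ Program λ P → ∃₂ λ (time nodes : ℕ → ℕ) →
    time ∈O (λ n → n * ⌈log₂ n ⌉) ×
    nodes ∈O (λ n → n) ×
    (∀ n (R : UnitWidthFamily F n) →
    ∃₂ λ s t → Run F P (input F R) s t × t ≤ time n ×
    ∃ λ m →
    Σ (TreeDecomposition (intersectionGraph F R) (suc m)) λ D →
    Σ (Layering (intersectionGraph F R)) λ L →
    Outputs (Store.out s) D L ×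
    suc m ≤ nodes n ×
    (∀ x i → α (intersectionGraph F R) (TreeDecomposition.bag D x ∩ Layering.part L i) ≤ 1)))
    × (∀ n (R : UnitWidthFamily F n) →
    ∃ λ k → IsLayeredTreeIndependenceNumber (intersectionGraph F R) k × k ≤ 1)
theorem4p12 F = (main , mainTime , (λ n → suc (n + n)) , mainTime∈O , nodes∈O , λ _ → algorithm) , λ _ → number≤1
  where
  nodes∈O : (λ n → suc (n + n)) ∈O (λ n → n)
  -- The root is absorbed by a third `n`, which needs `1 ≤ n`.
  nodes∈O = 3 , 1 , λ n 1≤n → ≤-trans (+-monoˡ-≤ (n + n) 1≤n) (≤-reflexive (cong (λ k → n + (n + k)) (sym (+-identityʳ n))))

  module _ {n} (R : UnitWidthFamily F n) where
    open Machine.Exec (Correctness.main-correct F R)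

    solution = proj₁ (proj₂ (proj₂ (proj₂ post)))

    open Assembly.FromSolved F R solution using (sweep; serialize-expected)
    open Decomposition F sweep

    outputs : Outputs (Store.out final) decomposition layering
    outputs = record
      { description = description
      ; describes   = describes
      ; serialized  = trans (proj₂ (proj₂ (proj₂ (proj₂ post)))) serialize-expected
      }

    algorithm : ∃₂ λ s t → Run F main (input F R) s t × t ≤ mainTime n ×
      ∃ λ m →
      Σ (TreeDecomposition (intersectionGraph F R) (suc m)) λ D →
      Σ (Layering (intersectionGraph F R)) λ L →
      Outputs (Store.out s) D L ×
      suc m ≤ suc (n + n) ×
      (∀ x i → α (intersectionGraph F R) (TreeDecomposition.bag D x ∩ Layering.part L i) ≤ 1)
    algorithm = final , steps , run , within , n + n , decomposition , layering , outputs , ≤-refl , α≤1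

    number≤1 : ∃ λ k → IsLayeredTreeIndependenceNumber (intersectionGraph F R) k × k ≤ 1
    number≤1 = layeredTreeIndependence≤1 (intersectionGraph F R) decomposition layering α≤1
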